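{- Let $G$ be a finite group acting (via a homomorphism $\Gamma_G: G \to S_A$) on a finite set $A = X \sqcup Y$ of cardinality $n$, and suppose the action is partition-preserving. Let $\Omega = \Omega_X \sqcup \Omega_Y$ be a set of colors, with weight functions $\omega_X:\Omega_X\to\mathbb{N}^+$ and $\omega_Y:\Omega_Y\to\mathbb{N}^+$ having only finitely many colors of each weight, and let $f_X$, $f_Y$ be their generating functions. Let $\Phi$ be the set of valid colorings of $A$. Then the action of $G$ on $A$ induces an action on $\Phi$ given by $(g\varphi)(a) = \varphi(ga)$, and, as formal power series, $$\sum_{w\ge 0} \#\{\text{orbits of } G \text{ on } \Phi \text{ consisting of colorings of total weight } w\}\, x^w \;=\; \tilde Z_G\big(f_X(x), f_X(x^2),\ldots, f_X(x^n), f_Y(x), f_Y(x^2),\ldots, f_Y(x^n)\big).$$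
   Context: For a finite set $A$, $S_A$ is the group of bijections $A\to A$; every element of $S_A$ decomposes uniquely (up to order) into pairwise disjoint cycles. An action $\Gamma_G$ of $G$ on $A = X\sqcup Y$ is partition-preserving if for all $g\in G$ and $a\in A$: $ga\in X \iff a\in X$ and $ga\in Y\iff a\in Y$; equivalently every cycle of every $\Gamma_G(g)$ lies entirely in $X$ or entirely in $Y$. For $g\in G$, $C_k^X(g)$ (resp. $C_k^Y(g)$) denotes the number of $k$-cycles in the disjoint cycle decomposition of $\Gamma_G(g)$ contained in $X$ (resp. $Y$), where fixed points count as 1-cycles. The bipartite cycle index is the polynomial $$\tilde Z_G(x_1,\ldots,x_n,y_1,\ldots,y_n) = \frac{1}{|G|}\sum_{g\in G} x_1^{C_1^X(g)}\cdots x_n^{C_n^X(g)}\, y_1^{C_1^Y(g)}\cdots y_n^{C_n^Y(g)}.$$ For a weight function $\omega:\Omega'\to\mathbb{N}$ with $|\omega^{ -1}(i)|$ finite for all $i$, its generating function is $f_\omega(x)=\sum_{i\ge 0}|\omega^{ -1}(i)|\,x^i$. A coloring $\varphi: A\to\Omega_X\sqcup\Omega_Y$ is valid if $\varphi(a)\in\Omega_X\iff a\in X$ and $\varphi(a)\in\Omega_Y\iff a\in Y$. The total weight of a valid coloring $\varphi$ is $\sum_{a\in X}\omega_X(\varphi(a)) + \sum_{a\in Y}\omega_Y(\varphi(a))$. -}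

module Defs where

open import Algebra.Bundles using (Group; RawSemiring)
open import Algebra.Morphism.Structures using (IsGroupHomomorphism)
import Algebra.Definitions.RawSemiring as SemiringDefs
import Algebra.Properties.CommutativeMonoid.Sum as Sum
open import Data.Bool.Base using (if_then_else_)
open import Data.Fin.Base using (Fin; toℕ)
import Data.Fin.Properties as Fin
open import Data.Integer.Base as ℤ using ()
open import Data.List.Base as List using (List; []; _∷_; applyUpTo; filter; length)
open import Data.List.Membership.Propositional using (_∈_)
open import Data.List.Membership.Propositional.Properties using (∈-applyUpTo⁺; ∈-applyUpTo⁻; ∈-tabulate⁺)
import Data.List.Membership.DecPropositional as DecMembership
open import Data.List.Relation.Binary.Disjoint.Propositional using (Disjoint)
open import Data.List.Relation.Unary.All as All using (All; all?)
open import Data.List.Relation.Unary.All.Properties using (¬Any⇒All¬)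
open import Data.List.Relation.Unary.AllPairs using (AllPairs; []; _∷_)
open import Data.List.Relation.Unary.Any as Any using (Any; here; there)
open import Data.List.Relation.Unary.Unique.Propositional using (Unique)
open import Data.List.Relation.Unary.Unique.Propositional.Properties using (applyUpTo⁺₁)
open import Data.Nat.Base as ℕ using (ℕ; zero; suc; NonZero; _∸_; _<_; s≤s; z≤n)
open import Data.Nat.Divisibility using (_∣?_)
open import Data.Nat.GeneralisedArithmetic using (fold)
import Data.Nat.Properties as ℕ
open import Data.Product.Base using (Σ; ∃; _×_; _,_; proj₁; proj₂)
open import Data.Rational.Base as ℚ using (ℚ; 0ℚ; 1ℚ)
import Data.Rational.Properties as ℚ
open import Data.Sum.Base using (_⊎_; inj₁; inj₂)
open import Data.Sum.Function.Propositional using (_⊎-↔_)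
open import Data.Vec.Functional as Vector using (Vector)
open import Function.Base using (_∘_; _on_)
open import Function.Bundles using (Inverse; Equivalence; _↔_; _⇔_)
import Function.Construct.Composition as Compose
import Function.Construct.Identity as Identity
import Function.Construct.Symmetry as Symmetry
open import Level using (Level; _⊔_; 0ℓ)
open import Relation.Binary.Bundles using (Setoid)
open import Relation.Binary.Definitions using (DecidableEquality)
import Relation.Binary.Construct.On as On
open import Relation.Binary.PropositionalEquality as ≡ using (_≡_; refl; sym; trans; cong; subst; _≗_)
open import Relation.Nullary.Decidable using (Dec; yes; no; does; _×-dec_)
open import Relation.Nullary.Negation using (¬_; contradiction)
open import Relation.Unary using (Pred; Decidable)

private
  variable
    a b c d ℓ s : Level

record FiniteSetoid (S : Setoid a ℓ) : Set (a ⊔ ℓ) where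
  field
    size        : ℕ
    enumeration : Inverse S (≡.setoid (Fin size))

  index : Setoid.Carrier S → Fin size
  index = Inverse.to enumeration

  element : Fin size → Setoid.Carrier S
  element = Inverse.from enumeration

Finite : Set a → Set a
Finite A = FiniteSetoid (≡.setoid A)

module _ {A : Set a} {B : Set b} (finA : Finite A) (finB : Finite B) where
  private
    module A = FiniteSetoid finA
    module B = FiniteSetoid finB

  ⊎-finite : Finite (A ⊎ B)
  ⊎-finite = record
    { size        = A.size ℕ.+ B.size
    ; enumeration = Compose.inverse (A.enumeration ⊎-↔ B.enumeration)
                                    (Symmetry.inverse Fin.+↔⊎)
    }

sumOver : {A : Set a} → Finite A → (A → ℕ) → ℕ
sumOver finA f = Sum.sum ℕ.+-0-commutativeMonoid (f ∘ FiniteSetoid.element finA)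

module _ (S : Setoid a ℓ) where
  open Setoid S using (_≈_) renaming (refl to ≈-refl; sym to ≈-sym; trans to ≈-trans)
  open Inverse using (to; from; to-cong; from-cong; strictlyInverseˡ; strictlyInverseʳ)

  -- The product σ ∙ τ applies τ first.
  symmetricGroup : Group (a ⊔ ℓ) (a ⊔ ℓ)
  symmetricGroup = record
    { Carrier = Inverse S S
    ; _≈_     = λ σ τ → ∀ x → to σ x ≈ to τ x
    ; _∙_     = λ σ τ → Compose.inverse τ σ
    ; ε       = Identity.inverse S
    ; _⁻¹     = Symmetry.inverse
    ; isGroup = record
      { isMonoid = record
        { isSemigroup = record
          { isMagma = record
            { isEquivalence = record
              { refl  = λ x → ≈-refl
              ; sym   = λ p x → ≈-sym (p x)
              ; trans = λ p q x → ≈-trans (p x) (q x)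
              }
            ; ∙-cong = λ {_} {σ′} p q x → ≈-trans (p _) (to-cong σ′ (q x))
            }
          ; assoc = λ _ _ _ _ → ≈-refl
          }
        ; identity = (λ _ _ → ≈-refl) , (λ _ _ → ≈-refl)
        }
      ; inverse = strictlyInverseʳ , strictlyInverseˡ
      ; ⁻¹-cong = λ {σ} {τ} p x →
          ≈-trans (≈-sym (strictlyInverseʳ τ (from σ x)))
                  (from-cong τ (≈-trans (≈-sym (p (from σ x))) (strictlyInverseˡ σ x)))
      }
    }

record Action (G : Group c d) (S : Setoid a ℓ) : Set (a ⊔ ℓ ⊔ c ⊔ d) where
  field
    Γ                   : Group.Carrier G → Inverse S S
    isGroupHomomorphism : IsGroupHomomorphism (Group.rawGroup G) (Group.rawGroup (symmetricGroup S)) Γ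

  act : Group.Carrier G → Setoid.Carrier S → Setoid.Carrier S
  act g = Inverse.to (Γ g)

module _ {G : Group c d} {S : Setoid a ℓ} (α : Action G S) where
  private
    module G = Group G
  open Setoid S using (_≈_) renaming (Carrier to A; refl to ≈-refl; sym to ≈-sym; trans to ≈-trans)
  open Action α
  open IsGroupHomomorphism isGroupHomomorphism using (ε-homo; ⁻¹-homo; homo)

  -- Quotients are represented by setoids: an orbit is an element of S, and
  -- two elements are equal as orbits when some g carries one to the other.
  orbits : Setoid a (c ⊔ ℓ)
  orbits = record
    { Carrier       = A
    ; _≈_           = λ x y → ∃ λ g → act g x ≈ y
    ; isEquivalence = record
      { refl  = λ {x} → G.ε , ε-homo x
      ; sym   = λ {x} {y} (g , gx≈y) → g G.⁻¹ ,
          ≈-trans (⁻¹-homo g y)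
            (≈-trans (Inverse.from-cong (Γ g) (≈-sym gx≈y)) (Inverse.strictlyInverseʳ (Γ g) x))
      ; trans = λ {x} (g , gx≈y) (h , hy≈z) → h G.∙ g ,
          ≈-trans (homo h g x) (≈-trans (Inverse.to-cong (Γ h) gx≈y) hy≈z)
      }
    }

  orbitsConsistingOf : Pred A s → Setoid (a ⊔ c ⊔ ℓ ⊔ s) (c ⊔ ℓ)
  orbitsConsistingOf P = record
    { Carrier       = ∃ λ x → ∀ y → Setoid._≈_ orbits x y → P y
    ; isEquivalence = On.isEquivalence proj₁ (Setoid.isEquivalence orbits)
    }

module _ {A : Set a} where
  open Inverse using (to)

  infixr 8 _^_·_
  _^_·_ : A ↔ A → ℕ → A → A
  σ ^ i · x = fold x (to σ) i

  -- The cycle (x, σ x, …, σᵏ⁻¹ x) of σ, with k = size ≥ 1 distinct entries.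
  record Cycle (σ : A ↔ A) : Set a where
    field
      base   : A
      size   : ℕ
      size>0 : 0 < size
      closed : σ ^ size · base ≡ base

    points : List A
    points = applyUpTo (λ i → σ ^ i · base) size

    field
      distinct : Unique points

  open Cycle using (points)

  -- Every a ∈ A lies on one of the pairwise disjoint cycles of σ, so σ is
  -- their product; a fixed point lies on a cycle of size 1.
  record CycleDecomposition (σ : A ↔ A) : Set a where
    field
      cycles   : List (Cycle σ)
      disjoint : AllPairs (Disjoint on points) cycles
      covers   : ∀ x → Any (λ γ → x ∈ points γ) cycles

  module _ (finA : Finite A) (σ : A ↔ A) where
    private
      module A = FiniteSetoid finA

      _≟_ : DecidableEquality A
      x ≟ y with A.index x Fin.≟ A.index y
      ... | yes p = yes (trans (sym (Inverse.strictlyInverseʳ A.enumeration x))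
                          (trans (cong A.element p) (Inverse.strictlyInverseʳ A.enumeration y)))
      ... | no ¬p = no (¬p ∘ cong A.index)

      open DecMembership _≟_ using (_∈?_)

      pts : Cycle σ → List A
      pts = points

      injective : ∀ {x y} → to σ x ≡ to σ y → x ≡ y
      injective {x} {y} p = trans (sym (Inverse.strictlyInverseʳ σ x))
        (trans (cong (Inverse.from σ) p) (Inverse.strictlyInverseʳ σ y))

      cancel : ∀ {x} i j → i < j → σ ^ i · x ≡ σ ^ j · x → ∃ λ k → k < j × σ ^ suc k · x ≡ x
      cancel zero    (suc j) _         p = j , ℕ.≤-refl , sym p
      cancel (suc i) (suc j) (s≤s i<j) p with k , k<j , q ← cancel i j i<j (injective p) =
        k , ℕ.m<n⇒m<1+n k<j , q

      least : ∀ {P : ℕ → Set a} → (∀ i → Dec (P i)) → ∀ m → P m →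
              ∃ λ k → P k × (∀ {i} → i < k → ¬ P i)
      least {P} P? m pm with P? 0
      least {P} P? m       pm | yes p0 = 0 , p0 , λ ()
      least {P} P? zero    pm | no ¬p0 = contradiction pm ¬p0
      least {P} P? (suc m) pm | no ¬p0 with k , pk , min ← least (P? ∘ suc) m pm =
        suc k , pk , λ { {zero} _ → ¬p0 ; {suc i} (s≤s i<k) → min i<k }

      period : ∀ x → ∃ λ m → σ ^ suc m · x ≡ x
      period x with i , j , i<j , p ← Fin.pigeonhole (ℕ.n<1+n A.size) (λ i → A.index (σ ^ toℕ i · x))
        with m , _ , q ← cancel (toℕ i) (toℕ j) i<j
               (trans (sym (Inverse.strictlyInverseʳ A.enumeration _))
                 (trans (cong A.element p) (Inverse.strictlyInverseʳ A.enumeration _))) = m , q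

      cycleThrough : ∀ x → Σ (Cycle σ) λ γ → Cycle.base γ ≡ x
      cycleThrough x with m , p ← period x
        with k , q , min ← least (λ i → (σ ^ suc i · x) ≟ x) m p = record
          { base     = x
          ; size     = suc k
          ; size>0   = s≤s z≤n
          ; closed   = q
          ; distinct = applyUpTo⁺₁ _ (suc k) λ {i} {j} i<j j<1+k r →
              let l , l<j , t = cancel i j i<j r in min (ℕ.<-≤-trans l<j (ℕ.≤-pred j<1+k)) t
          } , refl

      base∈ : ∀ γ → Cycle.base γ ∈ pts γ
      base∈ γ = ∈-applyUpTo⁺ (λ i → σ ^ i · Cycle.base γ) (Cycle.size>0 γ)

      backwards : ∀ γ {z} → to σ z ∈ pts γ → z ∈ pts γ
      backwards γ σz∈ with ∈-applyUpTo⁻ (λ i → σ ^ i · Cycle.base γ) σz∈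
      backwards γ σz∈ | suc i , i<k , p =
        subst (_∈ pts γ) (sym (injective p))
          (∈-applyUpTo⁺ (λ i → σ ^ i · Cycle.base γ) (ℕ.<-trans (ℕ.n<1+n i) i<k))
      backwards γ@(record { base = x ; size = suc k ; closed = q }) σz∈ | zero , _ , p =
        subst (_∈ pts γ) (sym (injective {y = σ ^ k · x} (trans p (sym q))))
          (∈-applyUpTo⁺ (λ i → σ ^ i · x) (ℕ.n<1+n k))

      backwards* : ∀ γ i {z} → σ ^ i · z ∈ pts γ → z ∈ pts γ
      backwards* γ zero    z∈ = z∈
      backwards* γ (suc i) z∈ = backwards* γ i (backwards γ z∈)

      decomposeList : (xs : List A) → Σ (List (Cycle σ)) λ γs →
        AllPairs (Disjoint on pts) γs × (∀ {x} → x ∈ xs → Any (λ γ → x ∈ pts γ) γs)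
      decomposeList [] = [] , [] , λ ()
      decomposeList (x ∷ xs) with γs , dis , cov ← decomposeList xs
        with Any.any? (λ γ → x ∈? pts γ) γs
      ... | yes x∈γs = γs , dis , λ { (here refl) → x∈γs ; (there x∈) → cov x∈ }
      ... | no  x∉γs with γ , refl ← cycleThrough x =
        γ ∷ γs
        , All.map (λ {δ} x∉δ {z} (z∈γ , z∈δ) →
            let i , _ , p = ∈-applyUpTo⁻ (λ i → σ ^ i · x) z∈γ
            in  x∉δ (backwards* δ i (subst (_∈ pts δ) p z∈δ)))
            (¬Any⇒All¬ γs x∉γs) ∷ dis
        , λ { (here refl) → here (base∈ γ) ; (there x∈) → there (cov x∈) }

    cycleDecomposition : CycleDecomposition σ
    cycleDecomposition with γs , dis , cov ← decomposeList (List.tabulate A.element) = record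
      { cycles   = γs
      ; disjoint = dis
      ; covers   = λ x → cov (subst (_∈ _) (Inverse.strictlyInverseʳ A.enumeration x)
                                (∈-tabulate⁺ (A.index x)))
      }

    countCycles : {P : Pred A s} → Decidable P → ℕ → ℕ
    countCycles P? k = length (filter (λ γ → (Cycle.size γ ℕ.≟ k) ×-dec all? P? (points γ))
                                      (CycleDecomposition.cycles cycleDecomposition))

module _ {A : Set a} {B : Set b} where

  InLeft : Pred (A ⊎ B) (a ⊔ b)
  InLeft z = ∃ λ x → z ≡ inj₁ x

  InRight : Pred (A ⊎ B) (a ⊔ b)
  InRight z = ∃ λ y → z ≡ inj₂ y

  inLeft? : Decidable InLeft
  inLeft? (inj₁ x) = yes (x , refl)
  inLeft? (inj₂ y) = no λ ()

  inRight? : Decidable InRight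
  inRight? (inj₁ x) = no λ ()
  inRight? (inj₂ y) = yes (y , refl)

PartitionPreserving : {G : Group c d} {X : Set a} {Y : Set b} →
                      Action G (≡.setoid (X ⊎ Y)) → Set (c ⊔ a ⊔ b)
PartitionPreserving Γ = ∀ g z → (InLeft (act g z) ⇔ InLeft z) × (InRight (act g z) ⇔ InRight z)
  where open Action Γ

PowerSeries : Set
PowerSeries = ℕ → ℚ

one : PowerSeries
one zero    = 1ℚ
one (suc _) = 0ℚ

powerSeries : RawSemiring 0ℓ 0ℓ
powerSeries = record
  { Carrier = PowerSeries
  ; _≈_     = _≗_
  ; _+_     = λ f g m → f m ℚ.+ g m
  ; _*_     = λ f g m → Sum.sum ℚ.+-0-commutativeMonoid {suc m} λ i → f (toℕ i) ℚ.* g (m ∸ toℕ i)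
  ; 0#      = λ _ → 0ℚ
  ; 1#      = one
  }

fromℕ : ℕ → ℚ
fromℕ m = ℤ.+ m ℚ./ 1

-- The series f(xᵏ).
atPower : (k : ℕ) .{{_ : NonZero k}} → PowerSeries → PowerSeries
atPower k f m = if does (k ∣? m) then f (m ℕ./ k) else 0ℚ

-- f(x), f(x²), …, f(xⁿ)
atPowers : ∀ n → PowerSeries → Vector PowerSeries n
atPowers n f k = atPower (suc (toℕ k)) f

-- A polynomial in m variables, as a formal sum of terms q · z₁^e₁ ⋯ zₘ^eₘ.
Polynomial : ℕ → Set
Polynomial m = List (ℚ × Vector ℕ m)

infixr 7 _•_
_•_ : ℚ → PowerSeries → PowerSeries
(q • f) m = q ℚ.* f m

module _ {m} (z : Vector PowerSeries m) where
  open RawSemiring powerSeries using (_+_; 0#)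
  open SemiringDefs powerSeries using (_^_; product)

  evaluateTerm : ℚ × Vector ℕ m → PowerSeries
  evaluateTerm (q , e) = q • product (λ i → z i ^ e i)

  evaluate : Polynomial m → PowerSeries
  evaluate = List.foldr (λ t f → evaluateTerm t + f) 0#

module _ {G : Group c d} (finG : FiniteSetoid (Group.setoid G))
         {X : Set a} {Y : Set b} (finX : Finite X) (finY : Finite Y)
         (Γ : Action G (≡.setoid (X ⊎ Y))) where
  private
    finA : Finite (X ⊎ Y)
    finA = ⊎-finite finX finY

    module A = FiniteSetoid finA
    module G = FiniteSetoid finG

    instance
      |G|≢0 : NonZero G.size
      |G|≢0 = Fin.nonZeroIndex (G.index (Group.ε G))

  cyclesInX : ℕ → Group.Carrier G → ℕ
  cyclesInX k g = countCycles finA (Action.Γ Γ g) inLeft? k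

  cyclesInY : ℕ → Group.Carrier G → ℕ
  cyclesInY k g = countCycles finA (Action.Γ Γ g) inRight? k

  exponents : (ℕ → Group.Carrier G → ℕ) → Group.Carrier G → Vector ℕ A.size
  exponents C g k = C (suc (toℕ k)) g

  -- The variables are x₁, …, xₙ, y₁, …, yₙ in this order.
  bipartiteCycleIndex : Polynomial (A.size ℕ.+ A.size)
  bipartiteCycleIndex = List.tabulate λ i →
    let g = G.element i in ℤ.1ℤ ℚ./ G.size , exponents cyclesInX g Vector.++ exponents cyclesInY g

module _ {Ω : Set a} where

  FiniteFibres : (Ω → ℕ) → Set a
  FiniteFibres ω = ∀ i → Finite (∃ λ c → ω c ≡ i)

  generatingFunction : {ω : Ω → ℕ} → FiniteFibres ω → PowerSeries
  generatingFunction fin i = fromℕ (FiniteSetoid.size (fin i))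

record Coloring (X : Set a) (Y : Set b) (ΩX : Set c) (ΩY : Set d) : Set (a ⊔ b ⊔ c ⊔ d) where
  field
    color : X ⊎ Y → ΩX ⊎ ΩY
    valid : ∀ z → (InLeft (color z) ⇔ InLeft z) × (InRight (color z) ⇔ InRight z)

  colorX : X → ΩX
  colorX x = proj₁ (Equivalence.from (proj₁ (valid (inj₁ x))) (x , refl))

  colorY : Y → ΩY
  colorY y = proj₁ (Equivalence.from (proj₂ (valid (inj₂ y))) (y , refl))

  totalWeight : Finite X → Finite Y → (ΩX → ℕ) → (ΩY → ℕ) → ℕ
  totalWeight finX finY ωX ωY = sumOver finX (ωX ∘ colorX) ℕ.+ sumOver finY (ωY ∘ colorY)

colorings : (X : Set a) (Y : Set b) (ΩX : Set c) (ΩY : Set d) → Setoid (a ⊔ b ⊔ c ⊔ d) (a ⊔ b ⊔ c ⊔ d)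
colorings X Y ΩX ΩY = record
  { Carrier       = Coloring X Y ΩX ΩY
  ; _≈_           = λ φ ψ → Coloring.color φ ≗ Coloring.color ψ
  ; isEquivalence = record
    { refl  = λ _ → refl
    ; sym   = λ p z → sym (p z)
    ; trans = λ p q z → trans (p z) (q z)
    }
  }

{-# OPTIONS --safe #-}

-- For each weight w there are finitely many valid colorings of total weight w, and G permutes them,
-- so by Burnside's lemma the number of orbits is the average over g of the number of colorings of
-- weight w fixed by g.  A coloring is fixed by g exactly when it is constant on the cycles of g.
-- It is therefore a free choice of one color per cycle, and a color of weight i used on a k-cycle
-- contributes k i to the total weight.  Hence the fixed colorings have as generating function the
-- product, over the cycles of g, of f_X(xᵏ) or f_Y(xᵏ).
module Submission where

open import Defs
open import Algebra.Bundles using (CommutativeMonoid; CommutativeRing; Group; RawSemiring)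
import Algebra.Construct.Flip.Op as Op
import Algebra.Definitions.RawSemiring as SemiringDefs
open import Algebra.Morphism.Structures using (IsGroupHomomorphism)
import Algebra.Properties.CommutativeMonoid.Mult as MonoidMult
import Algebra.Properties.CommutativeMonoid.Sum as MonoidSum
import Algebra.Properties.Semiring.Sum as SemiringSum
open import Data.Bool.Base using (if_then_else_)
open import Data.Empty using (⊥)
open import Data.Fin.Base using (Fin; zero; suc; toℕ; fromℕ<; _↑ˡ_; _↑ʳ_; splitAt; join; combine; remQuot)
import Data.Fin.Permutation as Permutation
import Data.Fin.Properties as Fin
import Data.Integer.Base as ℤ
import Data.Integer.Properties as ℤ
open import Data.List.Base as List using (List; []; _∷_; length; filter; applyUpTo)
open import Data.List.Membership.Propositional using (_∈_)
open import Data.List.Membership.Propositional.Properties using (∈-applyUpTo⁺; ∈-applyUpTo⁻; ∈-lookup)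
open import Data.List.Relation.Binary.Disjoint.Propositional using (Disjoint)
open import Data.List.Relation.Unary.All as All using (All; all?)
import Data.List.Relation.Unary.All.Properties as All
open import Data.List.Relation.Unary.AllPairs using (AllPairs; _∷_)
import Data.List.Relation.Unary.Any as Any
import Data.List.Relation.Unary.Any.Properties as Any
open import Data.Nat.Base as ℕ using (ℕ; zero; suc; _+_; _*_; _∸_; _≤_; _<_; NonZero)
open import Data.Nat.Divisibility using (_∣?_; _∣_; m∣m*n)
import Data.Nat.DivMod as ℕ
import Data.Nat.Properties as ℕ
open import Data.Product.Base as Product using (Σ-syntax; ∃; _×_; _,_; proj₁; proj₂; swap)
open import Data.Product.Relation.Binary.Pointwise.NonDependent using (_×ₛ_)
open import Data.Rational.Base as ℚ using (ℚ; 0ℚ; toℚᵘ)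
import Data.Rational.Properties as ℚ
open import Data.Rational.Unnormalised.Base as ℚᵘ using (mkℚᵘ; *≡*)
import Data.Rational.Unnormalised.Properties as ℚᵘ
open import Data.Sum.Base as Sum using (_⊎_; inj₁; inj₂; [_,_]′)
open import Data.Sum.Properties using (inj₁-injective; inj₂-injective)
open import Data.Unit.Base using (⊤; tt)
open import Data.Vec.Functional as Vector using (Vector; _++_)
open import Function.Base using (_∘_; _on_)
open import Function.Bundles using (Inverse; Equivalence; _↔_; _⇔_; mk⇔)
import Function.Construct.Composition as Compose
import Function.Construct.Symmetry as Symmetry
open import Level using (Level; _⊔_; 0ℓ)
open import Relation.Binary.Bundles using (Setoid)
open import Relation.Binary.Definitions using (tri<; tri≈; tri>)
open import Relation.Binary.PropositionalEquality as ≡ using (_≡_; _≗_; setoid; refl; sym; trans; cong; cong₂; subst)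
open ≡ using (module ≡-Reasoning)
open import Relation.Nullary.Decidable using (Dec; yes; no; does; map′; dec-true; dec-false; _×-dec_)
open import Relation.Nullary.Negation using (¬_; contradiction)
open import Relation.Unary using (Pred; Decidable; U; _∩_; _⊆_)

open SemiringSum ℕ.+-*-semiring using (sum; sum-cong-≗; ∑-comm; ∑-permute; *-distribʳ-sum)

private
  module Σℚ = SemiringSum (CommutativeRing.semiring ℚ.+-*-commutativeRing)
  variable
    a b c d e ℓ ℓ′ p q : Level
    m n : ℕ

⟦_⟧ : {A : Set a} → Dec A → ℕ
⟦ A? ⟧ = if does A? then 1 else 0

⟦⟧-true : {A : Set a} (A? : Dec A) → A → ⟦ A? ⟧ ≡ 1
⟦⟧-true A? x rewrite dec-true A? x = refl

⟦⟧-false : {A : Set a} (A? : Dec A) → ¬ A → ⟦ A? ⟧ ≡ 0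
⟦⟧-false A? ¬x rewrite dec-false A? ¬x = refl

sum-const : ∀ n k → sum {n} (λ _ → k) ≡ n * k
sum-const zero    k = refl
sum-const (suc n) k = cong (k +_) (sum-const n k)

sum-zero : {f : Fin n → ℕ} → (∀ i → f i ≡ 0) → sum f ≡ 0
sum-zero {n} f≡0 = trans (sum-cong-≗ f≡0) (trans (sum-const n 0) (ℕ.*-zeroʳ n))

sum-pick : ∀ (j : Fin n) (f : Fin n → ℕ) → sum (λ i → ⟦ j Fin.≟ i ⟧ * f i) ≡ f j
sum-pick {suc n} zero f = trans (cong₂ _+_ (ℕ.*-identityˡ (f zero)) (sum-zero {n} λ _ → refl)) (ℕ.+-identityʳ _)
sum-pick (suc j) f = sum-pick j (f ∘ suc)

sum-indicator : ∀ (j : Fin n) → sum (λ i → ⟦ j Fin.≟ i ⟧) ≡ 1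
sum-indicator {n} j = trans (sum-cong-≗ {n} λ i → sym (ℕ.*-identityʳ _)) (sum-pick j λ _ → 1)

sum-↑ : ∀ m (f : Fin (m + n) → ℕ) → sum f ≡ sum (f ∘ (_↑ˡ n)) + sum (f ∘ (m ↑ʳ_))
sum-↑ zero    f = refl
sum-↑ (suc m) f = trans (cong (f zero +_) (sum-↑ m (f ∘ suc))) (sym (ℕ.+-assoc (f zero) _ _))

sum-fibres : ∀ (h : Fin m → Fin n) (f : Fin m → ℕ) → sum f ≡ sum λ j → sum λ i → ⟦ h i Fin.≟ j ⟧ * f i
sum-fibres h f = trans (sum-cong-≗ λ i → sym (sum-pick (h i) (λ _ → f i)))
                       (∑-comm λ i j → ⟦ h i Fin.≟ j ⟧ * f i)

record Card (S : Setoid a ℓ) (P : Pred (Setoid.Carrier S) p) (n : ℕ) : Set (a ⊔ ℓ ⊔ p) where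
  open Setoid S using (Carrier; _≈_)
  field
    element    : Fin n → Carrier
    satisfies  : ∀ i → P (element i)
    injective  : ∀ {i j} → element i ≈ element j → i ≡ j
    surjective : ∀ {x} → P x → ∃ λ i → element i ≈ x

open Card

module _ {S : Setoid a ℓ} where
  open Setoid S using (Carrier; _≈_) renaming (refl to ≈-refl; sym to ≈-sym; trans to ≈-trans)

  card-mono : {P : Pred Carrier p} {Q : Pred Carrier q} → P ⊆ Q → Card S P m → Card S Q n → m ≤ n
  card-mono P⊆Q cP cQ = Fin.injective⇒≤ {f = λ i → proj₁ (preimage i)} λ {i} {j} eq →
    injective cP (≈-trans (≈-sym (proj₂ (preimage i)))
      (≈-trans (Setoid.reflexive S (cong (element cQ) eq)) (proj₂ (preimage j))))
    where preimage = λ i → surjective cQ (P⊆Q (satisfies cP i))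

  card-unique : {P : Pred Carrier p} {Q : Pred Carrier q} → P ⊆ Q → Q ⊆ P → Card S P m → Card S Q n → m ≡ n
  card-unique P⊆Q Q⊆P cP cQ = ℕ.≤-antisym (card-mono P⊆Q cP cQ) (card-mono Q⊆P cQ cP)

  card-empty : {P : Pred Carrier p} → (∀ x → ¬ P x) → Card S P 0
  card-empty ¬P = record
    { element    = λ ()
    ; satisfies  = λ ()
    ; injective  = λ {}
    ; surjective = λ {x} px → contradiction px (¬P x)
    }

  card-singleton : {P : Pred Carrier p} (x : Carrier) → P x → (∀ {y} → P y → x ≈ y) → Card S P 1
  card-singleton x px unique = record
    { element    = λ _ → x
    ; satisfies  = λ _ → px
    ; injective  = λ { {zero} {zero} _ → refl }
    ; surjective = λ py → zero , unique py
    }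

  card-resp : {P : Pred Carrier p} {Q : Pred Carrier q} → P ⊆ Q → Q ⊆ P → Card S P n → Card S Q n
  card-resp P⊆Q Q⊆P cP = record
    { element    = element cP
    ; satisfies  = λ i → P⊆Q (satisfies cP i)
    ; injective  = injective cP
    ; surjective = λ qx → surjective cP (Q⊆P qx)
    }

  card-∪ : {P : Pred Carrier p} {Q : Pred Carrier q} → (∀ {x y} → P x → Q y → ¬ x ≈ y) →
           Card S P m → Card S Q n → Card S (λ x → P x ⊎ Q x) (m + n)
  card-∪ {m = m} {n = n} {P = P} {Q} disjoint cP cQ = record
    { element    = elt ∘ splitAt m
    ; satisfies  = λ i → sat (splitAt m i)
    ; injective  = λ {i} {j} eq → trans (sym (Fin.join-splitAt m n i))
        (trans (cong (join m n) (inj (splitAt m i) (splitAt m j) eq)) (Fin.join-splitAt m n j))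
    ; surjective = λ x∈ → let s , eq = sur x∈ in
        join m n s , subst (λ s → elt s ≈ _) (sym (Fin.splitAt-join m n s)) eq
    }
    where
    elt : Fin m ⊎ Fin n → Carrier
    elt = [ element cP , element cQ ]′

    sat : ∀ s → P (elt s) ⊎ Q (elt s)
    sat (inj₁ i) = inj₁ (satisfies cP i)
    sat (inj₂ j) = inj₂ (satisfies cQ j)

    inj : ∀ s t → elt s ≈ elt t → s ≡ t
    inj (inj₁ i) (inj₁ j) eq = cong inj₁ (injective cP eq)
    inj (inj₁ i) (inj₂ j) eq = contradiction eq (disjoint (satisfies cP i) (satisfies cQ j))
    inj (inj₂ i) (inj₁ j) eq = contradiction (≈-sym eq) (disjoint (satisfies cP j) (satisfies cQ i))
    inj (inj₂ i) (inj₂ j) eq = cong inj₂ (injective cQ eq)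

    sur : ∀ {x} → P x ⊎ Q x → ∃ λ s → elt s ≈ x
    sur (inj₁ px) = let i , eq = surjective cP px in inj₁ i , eq
    sur (inj₂ qx) = let j , eq = surjective cQ qx in inj₂ j , eq

  card-⋃ : ∀ {N : Fin n → ℕ} {P : Fin n → Pred Carrier p} →
           (∀ {i j x y} → P i x → P j y → x ≈ y → i ≡ j) →
           (∀ i → Card S (P i) (N i)) → Card S (λ x → ∃ λ i → P i x) (sum N)
  card-⋃ {n = zero}  disjoint cP = card-empty λ { _ (() , _) }
  card-⋃ {n = suc n} disjoint cP = card-resp
    (λ { (inj₁ px) → zero , px ; (inj₂ (i , px)) → suc i , px })
    (λ { (zero , px) → inj₁ px ; (suc i , px) → inj₂ (i , px) })
    (card-∪ (λ px (i , py) eq → Fin.0≢1+n (disjoint px py eq)) (cP zero)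
      (card-⋃ (λ px py eq → Fin.suc-injective (disjoint px py eq)) (cP ∘ suc)))

  card-∩ : {P : Pred Carrier p} {Q : Pred Carrier q} → (∀ {x y} → x ≈ y → Q x → Q y) →
           (cP : Card S P n) (Q? : ∀ i → Dec (Q (element cP i))) → Card S (P ∩ Q) (sum λ i → ⟦ Q? i ⟧)
  card-∩ {P = P} {Q} Q-resp cP Q? = card-resp
    (λ (i , _ , pqx) → pqx)
    (λ (px , qx) → let i , eq = surjective cP px in i , eq , px , qx)
    (card-⋃ (λ (eqx , _) (eqy , _) x≈y → injective cP (≈-trans eqx (≈-trans x≈y (≈-sym eqy)))) card-point)
    where
    card-point : ∀ i → Card S (λ x → element cP i ≈ x × P x × Q x) ⟦ Q? i ⟧
    card-point i with Q? i
    ... | yes q = card-singleton (element cP i) (≈-refl , satisfies cP i , q) proj₁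
    ... | no ¬q = card-empty λ x (eq , _ , qx) → ¬q (Q-resp (≈-sym eq) qx)

  card-image : (f : Fin n → Carrier) → (∀ i j → Dec (f i ≈ f j)) → ∃ (Card S λ x → ∃ λ i → f i ≈ x)
  card-image {n = zero}  f _ = 0 , card-empty λ { _ (() , _) }
  card-image {n = suc n} f f≈?
    with k , cf ← card-image (f ∘ suc) (λ i j → f≈? (suc i) (suc j))
    with Fin.any? (λ i → f≈? (suc i) zero)
  ... | yes (i , fi≈f0) = k , card-resp
          (λ (j , eq) → suc j , eq)
          (λ { (zero , eq) → i , ≈-trans fi≈f0 eq ; (suc j , eq) → j , eq })
          cf
  ... | no f0-new = suc k , card-resp
          (λ { (inj₁ eq) → zero , eq ; (inj₂ (i , eq)) → suc i , eq })
          (λ { (zero , eq) → inj₁ eq ; (suc i , eq) → inj₂ (i , eq) })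
          (card-∪ (λ f0≈x (i , fi≈y) x≈y → f0-new (i , ≈-trans fi≈y (≈-sym (≈-trans f0≈x x≈y))))
            (card-singleton (f zero) ≈-refl (λ eq → eq)) cf)

  card⇒finite : {P : Pred Carrier p} → Card S P n → (∀ x → P x) → FiniteSetoid S
  card⇒finite {n = n} cP all = record
    { size        = n
    ; enumeration = record
      { to        = λ x → proj₁ (surjective cP (all x))
      ; from      = element cP
      ; to-cong   = λ {x} {y} eq → injective cP
          (≈-trans (proj₂ (surjective cP (all x))) (≈-trans eq (≈-sym (proj₂ (surjective cP (all y))))))
      ; from-cong = λ { refl → ≈-refl }
      ; inverse   =
          (λ {x} {y} eq → injective cP (≈-trans (proj₂ (surjective cP (all y))) eq)) ,
          (λ { {x} refl → proj₂ (surjective cP (all x)) })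
      }
    }

module _ {S : Setoid a ℓ} {T : Setoid b ℓ′} where
  private
    module S = Setoid S
    module T = Setoid T

  card-map : {P : Pred S.Carrier p} {Q : Pred T.Carrier q} (f : ∀ x → P x → T.Carrier) →
             (∀ {x y} px py → x S.≈ y → f x px T.≈ f y py) →
             (∀ {x} px → Q (f x px)) →
             (∀ {x y} px py → f x px T.≈ f y py → x S.≈ y) →
             (∀ {y} → Q y → ∃ λ x → ∃ λ px → f x px T.≈ y) →
             Card S P n → Card T Q n
  card-map f f-cong f-sat f-inj f-sur cP = record
    { element    = λ i → f (element cP i) (satisfies cP i)
    ; satisfies  = λ i → f-sat (satisfies cP i)
    ; injective  = λ eq → injective cP (f-inj (satisfies cP _) (satisfies cP _) eq)
    ; surjective = λ qy → let x , px , fx≈y = f-sur qy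
                              i , eq = surjective cP px
                          in i , T.trans (f-cong (satisfies cP i) px eq) fx≈y
    }

  card-× : {P : Pred S.Carrier p} {Q : Pred T.Carrier q} →
           Card S P m → Card T Q n → Card (S ×ₛ T) (λ (x , y) → P x × Q y) (m * n)
  card-× {m = m} {n = n} cP cQ = record
    { element    = elt ∘ remQuot n
    ; satisfies  = λ i → satisfies cP (proj₁ (remQuot {m} n i)) , satisfies cQ (proj₂ (remQuot {m} n i))
    ; injective  = λ {i} {j} (eq₁ , eq₂) → trans (sym (Fin.combine-remQuot {m} n i))
        (trans (cong₂ combine (injective cP eq₁) (injective cQ eq₂)) (Fin.combine-remQuot {m} n j))
    ; surjective = λ (px , qy) →
        let i , eq₁ = surjective cP px
            j , eq₂ = surjective cQ qy
        in combine i j , subst (λ k → Setoid._≈_ (S ×ₛ T) (elt k) _)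
             (sym (Fin.remQuot-combine i j)) (eq₁ , eq₂)
    }
    where
    elt : Fin m × Fin n → S.Carrier × T.Carrier
    elt (i , j) = element cP i , element cQ j

-- Burnside's lemma

module Burnside
  {G : Group c d} (finG : FiniteSetoid (Group.setoid G)) {S : Setoid a ℓ} (β : Action G S)
  {P : Pred (Setoid.Carrier S) p} (P-resp : ∀ {x y} → Setoid._≈_ S x y → P x → P y)
  (P-invariant : ∀ g {x} → P x → P (Action.act β g x))
  (cP : Card S P n) where

  open Setoid S using (Carrier; _≈_) renaming (refl to ≈-refl; sym to ≈-sym; trans to ≈-trans)
  open Action β
  open IsGroupHomomorphism isGroupHomomorphism using (⟦⟧-cong; ε-homo; homo)
  private
    module G where
      open Group G public
      open FiniteSetoid finG public

    element-index : ∀ g → G.element (G.index g) G.≈ g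
    element-index = Inverse.strictlyInverseʳ G.enumeration

    index-element : ∀ k → G.index (G.element k) ≡ k
    index-element = Inverse.strictlyInverseˡ G.enumeration

  Fixed : G.Carrier → Pred Carrier ℓ
  Fixed g x = act g x ≈ x

  private
    pt : Fin n → Carrier
    pt = element cP

    move : G.Carrier → Fin n → Fin n
    move g i = proj₁ (surjective cP (P-invariant g (satisfies cP i)))

    pt-move : ∀ g i → pt (move g i) ≈ act g (pt i)
    pt-move g i = proj₂ (surjective cP (P-invariant g (satisfies cP i)))

    move-unique : ∀ g {i j} → act g (pt i) ≈ pt j → move g i ≡ j
    move-unique g eq = injective cP (≈-trans (pt-move g _) eq)

    move-sound : ∀ g {i j} → move g i ≡ j → act g (pt i) ≈ pt j
    move-sound g refl = ≈-sym (pt-move g _)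

    move-cong : ∀ {g h} → g G.≈ h → ∀ i → move g i ≡ move h i
    move-cong {g} {h} eq i = move-unique g (≈-trans (⟦⟧-cong eq (pt i)) (≈-sym (pt-move h i)))

    move-∙ : ∀ g h i → move (g G.∙ h) i ≡ move g (move h i)
    move-∙ g h i = move-unique (g G.∙ h) (≈-trans (homo g h (pt i))
      (≈-trans (Inverse.to-cong (Γ g) (≈-sym (pt-move h i))) (≈-sym (pt-move g (move h i)))))

    orbit : Fin n → Setoid.Carrier (orbitsConsistingOf β P)
    orbit i = pt i , λ y (g , gx≈y) → P-resp gx≈y (P-invariant g (satisfies cP i))

    _∼_ : Fin n → Fin n → Set _
    i ∼ j = Setoid._≈_ (orbitsConsistingOf β P) (orbit i) (orbit j)

    _∼?_ : ∀ i j → Dec (i ∼ j)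
    i ∼? j = map′
      (λ (k , eq) → G.element k , move-sound (G.element k) eq)
      (λ (g , eq) → G.index g , trans (move-cong (element-index g) i) (move-unique g eq))
      (Fin.any? λ k → move (G.element k) i Fin.≟ j)

    orbitCard = card-image {S = orbitsConsistingOf β P} orbit _∼?_

  finiteOrbits : FiniteSetoid (orbitsConsistingOf β P)
  finiteOrbits = card⇒finite (proj₂ orbitCard) λ (x , all) →
    let i , eq = surjective cP (all x (G.ε , ε-homo x)) in i , G.ε , ≈-trans (ε-homo (pt i)) eq

  private
    module O = FiniteSetoid finiteOrbits

    class : Fin n → Fin O.size
    class i = O.index (orbit i)

    representative : Fin O.size → Fin n
    representative r = proj₁ (satisfies (proj₂ orbitCard) r)

    class-sound : ∀ {i r} → class i ≡ r → representative r ∼ i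
    class-sound {i} {r} eq = ∼-trans {orbit (representative r)} {O.element r} {orbit i}
      (proj₂ (satisfies (proj₂ orbitCard) r))
      (∼-sym {orbit i} {O.element r}
        (∼-trans {orbit i} {O.element (class i)} {O.element r}
          (∼-sym {O.element (class i)} {orbit i} (Inverse.strictlyInverseʳ O.enumeration (orbit i)))
          (Setoid.reflexive (orbitsConsistingOf β P) (cong O.element eq))))
      where open Setoid (orbitsConsistingOf β P) using () renaming (sym to ∼-sym; trans to ∼-trans)

    class-complete : ∀ {i r} → representative r ∼ i → class i ≡ r
    class-complete {i} {r} rep∼i = trans
      (Inverse.to-cong O.enumeration {orbit i} {O.element r}
        (∼-sym {O.element r} {orbit i} (∼-trans {O.element r} {orbit (representative r)} {orbit i}
          (∼-sym {orbit (representative r)} {O.element r} (proj₂ (satisfies (proj₂ orbitCard) r))) rep∼i)))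
      (Inverse.strictlyInverseˡ O.enumeration r)
      where open Setoid (orbitsConsistingOf β P) using () renaming (sym to ∼-sym; trans to ∼-trans)

    rightTranslation : G.Carrier → Permutation.Permutation′ G.size
    rightTranslation h = Permutation.permutation (translate h) (translate (h G.⁻¹))
      (λ k → trans (translate-∙ (h G.⁻¹) h k)
        (trans (Inverse.to-cong G.enumeration (G.trans (G.∙-congˡ (G.inverseˡ h)) (G.identityʳ _))) (index-element k)))
      (λ k → trans (translate-∙ h (h G.⁻¹) k)
        (trans (Inverse.to-cong G.enumeration (G.trans (G.∙-congˡ (G.inverseʳ h)) (G.identityʳ _))) (index-element k)))
      where
      translate : G.Carrier → Fin G.size → Fin G.size
      translate h k = G.index (G.element k G.∙ h)

      translate-∙ : ∀ g h k → translate h (translate g k) ≡ G.index (G.element k G.∙ (g G.∙ h))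
      translate-∙ g h k = Inverse.to-cong G.enumeration
        (G.trans (G.∙-congʳ (element-index _)) (G.assoc _ g h))

    -- If i = h · j, then g ↦ g h maps the stabiliser of i onto the set of elements carrying j to i.
    stabiliser : ∀ {i j} h → move h j ≡ i →
      sum (λ k → ⟦ move (G.element k) i Fin.≟ i ⟧) ≡ sum (λ k → ⟦ move (G.element k) j Fin.≟ i ⟧)
    stabiliser {i} {j} h refl = trans
      (sum-cong-≗ λ k → cong (λ l → ⟦ l Fin.≟ i ⟧)
        (sym (trans (move-cong (element-index (G.element k G.∙ h)) j) (move-∙ (G.element k) h j))))
      (sym (∑-permute (λ k → ⟦ move (G.element k) j Fin.≟ i ⟧) (rightTranslation h)))

    orbitSum : ∀ r → sum (λ i → ⟦ class i Fin.≟ r ⟧ * sum (λ k → ⟦ move (G.element k) i Fin.≟ i ⟧)) ≡ G.size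
    orbitSum r = trans (sum-cong-≗ term) (trans (∑-comm λ i k → ⟦ move (G.element k) j Fin.≟ i ⟧)
      (trans (sum-cong-≗ λ k → sum-indicator (move (G.element k) j))
        (trans (sum-const G.size 1) (ℕ.*-identityʳ G.size))))
      where
      j = representative r

      term : ∀ i → ⟦ class i Fin.≟ r ⟧ * sum (λ k → ⟦ move (G.element k) i Fin.≟ i ⟧)
                 ≡ sum (λ k → ⟦ move (G.element k) j Fin.≟ i ⟧)
      term i with class i Fin.≟ r
      ... | yes i∈r = let h , eq = class-sound i∈r in trans (ℕ.*-identityˡ _) (stabiliser h (move-unique h eq))
      ... | no  i∉r = sym (sum-zero λ k → ⟦⟧-false (_ Fin.≟ i)
                        λ eq → i∉r (class-complete (G.element k , move-sound (G.element k) eq)))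

  burnside : (F : Fin G.size → ℕ) → (∀ k → Card S (P ∩ Fixed (G.element k)) (F k)) →
             FiniteSetoid.size finiteOrbits * G.size ≡ sum F
  burnside F cF = sym (trans (sum-cong-≗ fixed) (trans (∑-comm λ k i → ⟦ move (G.element k) i Fin.≟ i ⟧)
    (trans (sum-fibres class _) (trans (sum-cong-≗ orbitSum) (sum-const O.size G.size)))))
    where
    fixed : ∀ k → F k ≡ sum λ i → ⟦ move (G.element k) i Fin.≟ i ⟧
    fixed k = card-unique (λ x∈ → x∈) (λ x∈ → x∈) (cF k) (card-∩
      (λ x≈y gx≈x → ≈-trans (Inverse.to-cong (Γ (G.element k)) (≈-sym x≈y)) (≈-trans gx≈x x≈y)) cP
      (λ i → map′ (move-sound (G.element k)) (move-unique (G.element k)) (move (G.element k) i Fin.≟ i)))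

toℚᵘ-fromℕ : ∀ m → toℚᵘ (fromℕ m) ℚᵘ.≃ mkℚᵘ (ℤ.+ m) 0
toℚᵘ-fromℕ m = ℚ.toℚᵘ-fromℚᵘ (mkℚᵘ (ℤ.+ m) 0)

fromℕ-+ : ∀ m n → fromℕ (m + n) ≡ fromℕ m ℚ.+ fromℕ n
fromℕ-+ m n = ℚ.toℚᵘ-injective (begin
  toℚᵘ (fromℕ (m + n))                ≈⟨ toℚᵘ-fromℕ (m + n) ⟩
  mkℚᵘ (ℤ.+ (m + n)) 0                ≈⟨ *≡* (cong (ℤ._* ℤ.1ℤ) numerators) ⟨
  mkℚᵘ (ℤ.+ m) 0 ℚᵘ.+ mkℚᵘ (ℤ.+ n) 0  ≈⟨ ℚᵘ.+-cong (toℚᵘ-fromℕ m) (toℚᵘ-fromℕ n) ⟨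
  toℚᵘ (fromℕ m) ℚᵘ.+ toℚᵘ (fromℕ n)  ≈⟨ ℚ.toℚᵘ-homo-+ (fromℕ m) (fromℕ n) ⟨
  toℚᵘ (fromℕ m ℚ.+ fromℕ n)          ∎)
  where
  open import Relation.Binary.Reasoning.Setoid ℚᵘ.≃-setoid
  numerators : ℤ.+ m ℤ.* ℤ.1ℤ ℤ.+ ℤ.+ n ℤ.* ℤ.1ℤ ≡ ℤ.+ (m + n)
  numerators = cong₂ ℤ._+_ (ℤ.*-identityʳ (ℤ.+ m)) (ℤ.*-identityʳ (ℤ.+ n))

fromℕ-* : ∀ m n → fromℕ (m * n) ≡ fromℕ m ℚ.* fromℕ n
fromℕ-* m n = ℚ.toℚᵘ-injective (begin
  toℚᵘ (fromℕ (m * n))                ≈⟨ toℚᵘ-fromℕ (m * n) ⟩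
  mkℚᵘ (ℤ.+ (m * n)) 0                ≈⟨ *≡* (cong (ℤ._* ℤ.1ℤ) (ℤ.pos-* m n)) ⟩
  mkℚᵘ (ℤ.+ m) 0 ℚᵘ.* mkℚᵘ (ℤ.+ n) 0  ≈⟨ ℚᵘ.*-cong (toℚᵘ-fromℕ m) (toℚᵘ-fromℕ n) ⟨
  toℚᵘ (fromℕ m) ℚᵘ.* toℚᵘ (fromℕ n)  ≈⟨ ℚ.toℚᵘ-homo-* (fromℕ m) (fromℕ n) ⟨
  toℚᵘ (fromℕ m ℚ.* fromℕ n)          ∎)
  where open import Relation.Binary.Reasoning.Setoid ℚᵘ.≃-setoid

fromℕ-sum : (f : Fin n → ℕ) → fromℕ (sum f) ≡ Σℚ.sum (fromℕ ∘ f)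
fromℕ-sum {zero}  f = refl
fromℕ-sum {suc n} f = trans (fromℕ-+ (f zero) (sum (f ∘ suc))) (cong (fromℕ (f zero) ℚ.+_) (fromℕ-sum (f ∘ suc)))

1/n*[m*n]≡m : ∀ m n .{{_ : NonZero n}} → (ℤ.1ℤ ℚ./ n) ℚ.* fromℕ (m * n) ≡ fromℕ m
1/n*[m*n]≡m m n@(suc k) = ℚ.toℚᵘ-injective (begin
  toℚᵘ ((ℤ.1ℤ ℚ./ n) ℚ.* fromℕ (m * n))        ≈⟨ ℚ.toℚᵘ-homo-* (ℤ.1ℤ ℚ./ n) (fromℕ (m * n)) ⟩
  toℚᵘ (ℤ.1ℤ ℚ./ n) ℚᵘ.* toℚᵘ (fromℕ (m * n))  ≈⟨ ℚᵘ.*-cong (ℚ.toℚᵘ-fromℚᵘ (mkℚᵘ ℤ.1ℤ k)) (toℚᵘ-fromℕ (m * n)) ⟩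
  mkℚᵘ ℤ.1ℤ k ℚᵘ.* mkℚᵘ (ℤ.+ (m * n)) 0        ≈⟨ *≡* eq ⟩
  mkℚᵘ (ℤ.+ m) 0                               ≈⟨ toℚᵘ-fromℕ m ⟨
  toℚᵘ (fromℕ m)                               ∎)
  where
  open import Relation.Binary.Reasoning.Setoid ℚᵘ.≃-setoid
  eq : (ℤ.1ℤ ℤ.* ℤ.+ (m * n)) ℤ.* ℤ.1ℤ ≡ ℤ.+ m ℤ.* ℤ.+ (n * 1)
  eq = trans (ℤ.*-identityʳ _) (trans (ℤ.*-identityˡ _)
    (trans (ℤ.pos-* m n) (cong (λ k → ℤ.+ m ℤ.* ℤ.+ k) (sym (ℕ.*-identityʳ n)))))

-- Formal power series as generating functions

open RawSemiring powerSeries using () renaming (_*_ to _⊛_; _+_ to _⊕_)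

private
  tail : PowerSeries → PowerSeries
  tail f m = f (suc m)

⊛-cong : ∀ {f f′ g g′} → f ≗ f′ → g ≗ g′ → f ⊛ g ≗ f′ ⊛ g′
⊛-cong f≗ g≗ m = Σℚ.sum-cong-≗ {suc m} λ i → cong₂ ℚ._*_ (f≗ (toℕ i)) (g≗ (m ∸ toℕ i))

⊛-distribʳ-⊕ : ∀ h f g → (f ⊕ g) ⊛ h ≗ (f ⊛ h) ⊕ (g ⊛ h)
⊛-distribʳ-⊕ h f g m = trans
  (Σℚ.sum-cong-≗ {suc m} λ i → ℚ.*-distribʳ-+ (h (m ∸ toℕ i)) (f (toℕ i)) (g (toℕ i)))
  (Σℚ.∑-distrib-+ {suc m} (λ i → f (toℕ i) ℚ.* h (m ∸ toℕ i)) (λ i → g (toℕ i) ℚ.* h (m ∸ toℕ i)))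

•-⊛-assoc : ∀ r f g → (r • f) ⊛ g ≗ r • (f ⊛ g)
•-⊛-assoc r f g m = trans
  (Σℚ.sum-cong-≗ {suc m} λ i → ℚ.*-assoc r (f (toℕ i)) (g (m ∸ toℕ i)))
  (sym (Σℚ.*-distribˡ-sum {suc m} r λ i → f (toℕ i) ℚ.* g (m ∸ toℕ i)))

⊛-assoc : ∀ f g h → (f ⊛ g) ⊛ h ≗ f ⊛ (g ⊛ h)
⊛-assoc f g h zero    = cong (ℚ._+ 0ℚ) (trans (cong (ℚ._* h 0) (ℚ.+-identityʳ (f 0 ℚ.* g 0)))
  (trans (ℚ.*-assoc (f 0) (g 0) (h 0)) (cong (f 0 ℚ.*_) (sym (ℚ.+-identityʳ (g 0 ℚ.* h 0))))))
⊛-assoc f g h (suc m) = begin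
  (f 0 ℚ.* g 0 ℚ.+ 0ℚ) ℚ.* h (suc m) ℚ.+ (((f 0 • tail g) ⊕ (tail f ⊛ g)) ⊛ h) m
    ≡⟨ cong ((f 0 ℚ.* g 0 ℚ.+ 0ℚ) ℚ.* h (suc m) ℚ.+_) (trans (⊛-distribʳ-⊕ h (f 0 • tail g) (tail f ⊛ g) m)
         (cong₂ ℚ._+_ (•-⊛-assoc (f 0) (tail g) h m) (⊛-assoc (tail f) g h m))) ⟩
  (f 0 ℚ.* g 0 ℚ.+ 0ℚ) ℚ.* h (suc m) ℚ.+ (f 0 ℚ.* (tail g ⊛ h) m ℚ.+ (tail f ⊛ (g ⊛ h)) m)
    ≡⟨ lemma (f 0) (g 0) (h (suc m)) _ _ ⟩
  f 0 ℚ.* (g 0 ℚ.* h (suc m) ℚ.+ (tail g ⊛ h) m) ℚ.+ (tail f ⊛ (g ⊛ h)) m ∎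
  where
  open ≡-Reasoning
  lemma : ∀ x y z s t → (x ℚ.* y ℚ.+ 0ℚ) ℚ.* z ℚ.+ (x ℚ.* s ℚ.+ t) ≡ x ℚ.* (y ℚ.* z ℚ.+ s) ℚ.+ t
  lemma x y z s t = begin
    (x ℚ.* y ℚ.+ 0ℚ) ℚ.* z ℚ.+ (x ℚ.* s ℚ.+ t)  ≡⟨ cong (λ r → r ℚ.* z ℚ.+ (x ℚ.* s ℚ.+ t)) (ℚ.+-identityʳ (x ℚ.* y)) ⟩
    x ℚ.* y ℚ.* z ℚ.+ (x ℚ.* s ℚ.+ t)           ≡⟨ cong (ℚ._+ (x ℚ.* s ℚ.+ t)) (ℚ.*-assoc x y z) ⟩
    x ℚ.* (y ℚ.* z) ℚ.+ (x ℚ.* s ℚ.+ t)         ≡⟨ ℚ.+-assoc (x ℚ.* (y ℚ.* z)) (x ℚ.* s) t ⟨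
    x ℚ.* (y ℚ.* z) ℚ.+ x ℚ.* s ℚ.+ t           ≡⟨ cong (ℚ._+ t) (ℚ.*-distribˡ-+ x (y ℚ.* z) s) ⟨
    x ℚ.* (y ℚ.* z ℚ.+ s) ℚ.+ t                 ∎

⊛-unfoldʳ : ∀ f g m → (f ⊛ g) (suc m) ≡ (f ⊛ tail g) m ℚ.+ f (suc m) ℚ.* g 0
⊛-unfoldʳ f g zero    = trans (cong (f 0 ℚ.* g 1 ℚ.+_) (ℚ.+-identityʳ (f 1 ℚ.* g 0)))
                              (cong (ℚ._+ f 1 ℚ.* g 0) (sym (ℚ.+-identityʳ (f 0 ℚ.* g 1))))
⊛-unfoldʳ f g (suc m) = trans (cong (f 0 ℚ.* g (suc (suc m)) ℚ.+_) (⊛-unfoldʳ (tail f) g m))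
                              (sym (ℚ.+-assoc (f 0 ℚ.* g (suc (suc m))) _ _))

⊛-comm : ∀ f g → f ⊛ g ≗ g ⊛ f
⊛-comm f g zero    = cong (ℚ._+ 0ℚ) (ℚ.*-comm (f 0) (g 0))
⊛-comm f g (suc m) = trans (cong₂ ℚ._+_ (ℚ.*-comm (f 0) (g (suc m))) (⊛-comm (tail f) g m))
  (trans (ℚ.+-comm (g (suc m) ℚ.* f 0) _) (sym (⊛-unfoldʳ g f m)))

⊛-identityˡ : ∀ f → one ⊛ f ≗ f
⊛-identityˡ f zero    = trans (ℚ.+-identityʳ _) (ℚ.*-identityˡ (f 0))
⊛-identityˡ f (suc m) = trans (cong₂ ℚ._+_ (ℚ.*-identityˡ (f (suc m)))
    (trans (Σℚ.sum-cong-≗ {suc m} λ i → ℚ.*-zeroˡ (f (m ∸ toℕ i))) (Σℚ.sum-replicate-zero (suc m))))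
  (ℚ.+-identityʳ _)

⊛-commutativeMonoid : CommutativeMonoid 0ℓ 0ℓ
⊛-commutativeMonoid = record
  { Carrier = PowerSeries
  ; _≈_     = _≗_
  ; _∙_     = _⊛_
  ; ε       = one
  ; isCommutativeMonoid = record
    { isMonoid = record
      { isSemigroup = record
        { isMagma = record
          { isEquivalence = Setoid.isEquivalence (ℕ ≡.→-setoid ℚ)
          ; ∙-cong = ⊛-cong
          }
        ; assoc = ⊛-assoc
        }
      ; identity = ⊛-identityˡ , λ f m → trans (⊛-comm f one m) (⊛-identityˡ f m)
      }
    ; comm = ⊛-comm
    }
  }

module _ (M : CommutativeMonoid a ℓ) where
  open CommutativeMonoid M
  open MonoidSum M renaming (sum to product)
  open MonoidMult M renaming (_×_ to _times_) using ()
  open import Relation.Binary.Reasoning.Setoid (CommutativeMonoid.setoid M)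

  product-single : ∀ {n} (j : Fin n) (t : Vector Carrier n) → (∀ i → ¬ i ≡ j → t i ≈ ε) → product t ≈ t j
  product-single {suc n} zero t rest = CommutativeMonoid.trans M (∙-congˡ (CommutativeMonoid.trans M
    (sum-cong-≋ λ i → rest (suc i) λ ()) (sum-replicate-zero n))) (identityʳ (t zero))
  product-single (suc j) t rest = CommutativeMonoid.trans M
    (∙-cong (rest zero λ ()) (product-single j (t ∘ suc) λ i i≢j → rest (suc i) (i≢j ∘ Fin.suc-injective)))
    (identityˡ _)

  -- Sorting the factors t x by the unique i with Q i x.
  product-sort : ∀ {A : Set b} {n} (z : Vector Carrier n) (t : A → Carrier)
    {Q : Fin n → Pred A p} (Q? : ∀ i → Decidable (Q i)) →
    (∀ x → ∃ λ j → Q j x × (∀ i → Q i x → i ≡ j) × t x ≈ z j) →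
    ∀ xs → product (λ i → length (filter (Q? i) xs) times z i) ≈ product (t ∘ List.lookup xs)
  product-sort {n = n} z t Q? sort []       = sum-replicate-zero n
  product-sort z t Q? sort (x ∷ xs) with j , qj , unique , tx≈zj ← sort x = begin
    product (λ i → length (filter (Q? i) (x ∷ xs)) times z i)
      ≈⟨ sum-cong-≋ step ⟩
    product (λ i → (⟦ Q? i x ⟧ times z i) ∙ (length (filter (Q? i) xs) times z i))
      ≈⟨ ∑-distrib-+ (λ i → ⟦ Q? i x ⟧ times z i) _ ⟩
    product (λ i → ⟦ Q? i x ⟧ times z i) ∙ product (λ i → length (filter (Q? i) xs) times z i)
      ≈⟨ ∙-cong head (product-sort z t Q? sort xs) ⟩
    t x ∙ product (t ∘ List.lookup xs) ∎
    where
    step : ∀ i → length (filter (Q? i) (x ∷ xs)) times z i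
               ≈ (⟦ Q? i x ⟧ times z i) ∙ (length (filter (Q? i) xs) times z i)
    step i with Q? i x
    ... | yes _ = ∙-congʳ (CommutativeMonoid.sym M (identityʳ (z i)))
    ... | no  _ = CommutativeMonoid.sym M (identityˡ _)

    head : product (λ i → ⟦ Q? i x ⟧ times z i) ≈ t x
    head = begin
      product (λ i → ⟦ Q? i x ⟧ times z i)
        ≈⟨ product-single j _ (λ i i≢j → reflexive (cong (_times z i) (⟦⟧-false (Q? i x) (i≢j ∘ unique i)))) ⟩
      ⟦ Q? j x ⟧ times z j  ≈⟨ reflexive (cong (_times z j) (⟦⟧-true (Q? j x) qj)) ⟩
      z j ∙ ε               ≈⟨ identityʳ (z j) ⟩
      z j                   ≈⟨ tx≈zj ⟨
      t x                   ∎

record Series (S : Setoid a ℓ) (P : Pred (Setoid.Carrier S) p) (u : Setoid.Carrier S → ℕ)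
              (f : PowerSeries) : Set (a ⊔ ℓ ⊔ p) where
  open Setoid S
  field
    u-cong : ∀ {x y} → x ≈ y → u x ≡ u y
    count  : ℕ → ℕ
    card   : ∀ w → Card S (λ x → P x × u x ≡ w) (count w)
    coeff  : ∀ w → f w ≡ fromℕ (count w)

open Series

module _ {S : Setoid a ℓ} {P : Pred (Setoid.Carrier S) p} {u : Setoid.Carrier S → ℕ} where
  open Setoid S using (Carrier; _≈_)

  series-one : (x : Carrier) → P x → (∀ y → x ≈ y) → (∀ y → u y ≡ 0) → Series S P u one
  series-one x px unique u≡0 = record
    { u-cong = λ {y} {z} _ → trans (u≡0 y) (sym (u≡0 z))
    ; count  = λ { zero → 1 ; (suc _) → 0 }
    ; card   = λ { zero    → card-singleton x (px , u≡0 x) (λ _ → unique _)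
                 ; (suc _) → card-empty λ y (_ , uy≡1+w) → ℕ.0≢1+n (trans (sym (u≡0 y)) uy≡1+w) }
    ; coeff  = λ { zero → refl ; (suc _) → refl }
    }

  series-scale : ∀ {f} k .{{_ : NonZero k}} → Series S P u f → Series S P (λ x → k * u x) (atPower k f)
  series-scale {f} k s = record
    { u-cong = λ x≈y → cong (k *_) (u-cong s x≈y)
    ; count  = λ w → proj₁ (scaled w)
    ; card   = λ w → proj₁ (proj₂ (scaled w))
    ; coeff  = λ w → proj₂ (proj₂ (scaled w))
    }
    where
    scaled : ∀ w → ∃ λ n → Card S (λ x → P x × k * u x ≡ w) n × atPower k f w ≡ fromℕ n
    scaled w with k ∣? w
    ... | yes k∣w = count s (w ℕ./ k)
                  , card-resp
                      (λ (px , eq) → px , trans (cong (k *_) eq) (ℕ.m*[n/m]≡n k∣w))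
                      (λ {x} (px , eq) → px , trans (sym (ℕ.m*n/n≡m (u x) k))
                        (cong (ℕ._/ k) (trans (ℕ.*-comm (u x) k) eq)))
                      (card s (w ℕ./ k))
                  , coeff s (w ℕ./ k)
    ... | no  k∤w = 0 , card-empty (λ x (_ , eq) → k∤w (subst (k ∣_) eq (m∣m*n (u x)))) , refl

module _ {S : Setoid a ℓ} {T : Setoid b ℓ′} {P : Pred (Setoid.Carrier S) p} {Q : Pred (Setoid.Carrier T) q}
         {u : Setoid.Carrier S → ℕ} {v : Setoid.Carrier T → ℕ} where
  private
    module S = Setoid S
    module T = Setoid T

  series-map : ∀ {f} (h : ∀ x → P x → T.Carrier) →
    (∀ {x y} px py → x S.≈ y → h x px T.≈ h y py) →
    (∀ {x} px → Q (h x px)) →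
    (∀ {x y} px py → h x px T.≈ h y py → x S.≈ y) →
    (∀ {y} → Q y → ∃ λ x → ∃ λ px → h x px T.≈ y) →
    (∀ {x y} → x T.≈ y → v x ≡ v y) →
    (∀ {x} px → v (h x px) ≡ u x) →
    Series S P u f → Series T Q v f
  series-map h h-cong h-sat h-inj h-sur v-cong weight s = record
    { u-cong = v-cong
    ; count  = count s
    ; card   = λ w → card-map (λ x (px , _) → h x px)
        (λ (px , _) (py , _) → h-cong px py)
        (λ (px , eq) → h-sat px , trans (weight px) eq)
        (λ (px , _) (py , _) → h-inj px py)
        (λ (qy , eq) → let x , px , hx≈y = h-sur qy in
           x , (px , trans (sym (weight px)) (trans (v-cong hx≈y) eq)) , hx≈y)
        (card s w)
    ; coeff  = coeff s
    }

  series-× : ∀ {f g} → Series S P u f → Series T Q v g →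
             Series (S ×ₛ T) (λ (x , y) → P x × Q y) (λ (x , y) → u x + v y) (f ⊛ g)
  series-× {f} {g} s t = record
    { u-cong = λ (x≈x′ , y≈y′) → cong₂ _+_ (u-cong s x≈x′) (u-cong t y≈y′)
    ; count  = λ w → sum {suc w} λ i → count s (toℕ i) * count t (w ∸ toℕ i)
    ; card   = λ w → card-resp (to w) (from w) (card-⋃ {n = suc w}
        (λ ((_ , ux≡i) , _) ((_ , uy≡j) , _) (x≈y , _) →
          Fin.toℕ-injective (trans (sym ux≡i) (trans (u-cong s x≈y) uy≡j)))
        (λ i → card-× (card s (toℕ i)) (card t (w ∸ toℕ i))))
    ; coeff  = λ w → trans
        (Σℚ.sum-cong-≗ {suc w} λ i → trans (cong₂ ℚ._*_ (coeff s (toℕ i)) (coeff t (w ∸ toℕ i)))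
          (sym (fromℕ-* (count s (toℕ i)) (count t (w ∸ toℕ i)))))
        (sym (fromℕ-sum {suc w} λ i → count s (toℕ i) * count t (w ∸ toℕ i)))
    }
    where
    Summand : ∀ w → Fin (suc w) → Pred (S.Carrier × T.Carrier) _
    Summand w i (x , y) = (P x × u x ≡ toℕ i) × (Q y × v y ≡ w ∸ toℕ i)

    to : ∀ w {z@(x , y) : S.Carrier × T.Carrier} → (∃ λ i → Summand w i z) → (P x × Q y) × u x + v y ≡ w
    to w (i , (px , ux≡i) , (qy , vy≡w∸i)) =
      (px , qy) , trans (cong₂ _+_ ux≡i vy≡w∸i) (ℕ.m+[n∸m]≡n (ℕ.≤-pred (Fin.toℕ<n i)))

    from : ∀ w {z@(x , y) : S.Carrier × T.Carrier} → (P x × Q y) × u x + v y ≡ w → ∃ λ i → Summand w i z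
    from w {x , y} ((px , qy) , refl) =
      fromℕ< ux<1+w , (px , sym (Fin.toℕ-fromℕ< ux<1+w)) ,
      (qy , sym (trans (cong (w ∸_) (Fin.toℕ-fromℕ< ux<1+w)) (ℕ.m+n∸m≡n (u x) (v y))))
      where ux<1+w = ℕ.s≤s (ℕ.m≤m+n (u x) (v y))

open SemiringDefs powerSeries using (product; _^_)

series-Π : ∀ {A : Set a} {m} {P : Fin m → Pred A p} {u : Fin m → A → ℕ} {f : Fin m → PowerSeries} →
           (∀ i → Series (≡.setoid A) (P i) (u i) (f i)) →
           Series (Fin m ≡.→-setoid A) (λ t → ∀ i → P i (t i)) (λ t → sum λ i → u i (t i)) (product f)
series-Π {m = zero}  s = series-one (λ ()) (λ ()) (λ _ ()) (λ _ → refl)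
series-Π {A = A} {m = suc m} s = series-map
  (λ (x , t) _ → x Vector.∷ t)
  (λ { _ _ (x≡y , _) zero → x≡y ; _ _ (_ , t≗) (suc i) → t≗ i })
  (λ { (px , pt) zero → px ; (px , pt) (suc i) → pt i })
  (λ _ _ eq → eq zero , eq ∘ suc)
  (λ {t} pt → (t zero , t ∘ suc) , (pt zero , pt ∘ suc) , λ { zero → refl ; (suc i) → refl })
  (λ t≗ → sum-cong-≗ λ i → u-cong (s i) (t≗ i))
  (λ _ → refl)
  (series-× (s zero) (series-Π (s ∘ suc)))

series-fibres : {A : Set a} {B : Set b} {u : A → ℕ} {v : B → ℕ} {P : Pred B p}
  (fin : FiniteFibres u) (ι : A → B) → (∀ {x y} → ι x ≡ ι y → x ≡ y) →
  (∀ x → P (ι x)) → (∀ {y} → P y → ∃ λ x → ι x ≡ y) → (∀ x → v (ι x) ≡ u x) →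
  Series (≡.setoid B) P v (generatingFunction fin)
series-fibres {A = A} {u = u} {v} fin ι ι-injective ι-sat ι-sur weight = record
  { u-cong = cong v
  ; count  = λ w → F.size w
  ; card   = λ w → record
    { element    = λ i → ι (proj₁ (F.element w i))
    ; satisfies  = λ i → ι-sat _ , trans (weight _) (proj₂ (F.element w i))
    ; injective  = λ {i} {j} eq → trans (sym (Inverse.strictlyInverseˡ (F.enumeration w) i))
        (trans (cong (F.index w) (pair-≡ (ι-injective eq))) (Inverse.strictlyInverseˡ (F.enumeration w) j))
    ; surjective = λ { (py , vy≡w) → surj w (ι-sur py) vy≡w }
    }
  ; coeff  = λ w → refl
  }
  where
  module F w = FiniteSetoid (fin w)

  pair-≡ : ∀ {w} {x y : ∃ λ κ → u κ ≡ w} → proj₁ x ≡ proj₁ y → x ≡ y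
  pair-≡ {x = κ , p} {_ , q} refl = cong (κ ,_) (ℕ.≡-irrelevant p q)

  surj : ∀ w {y} → (∃ λ x → ι x ≡ y) → v y ≡ w → ∃ λ i → ι (proj₁ (F.element w i)) ≡ y
  surj w (x , refl) vy≡w = F.index w x∈w , cong (ι ∘ proj₁) (Inverse.strictlyInverseʳ (F.enumeration w) x∈w)
    where x∈w = x , trans (sym (weight x)) vy≡w

-- Cycles of a permutation

allPairs-applyUpTo⁻ : ∀ {A : Set a} {R : A → A → Set p} (f : ℕ → A) n → AllPairs R (applyUpTo f n) →
                      ∀ {i j} → i < j → j < n → R (f i) (f j)
allPairs-applyUpTo⁻ f (suc n) (r ∷ rs) {zero}  {suc j} _ (ℕ.s≤s j<n) = All.applyUpTo⁻ (f ∘ suc) n r j<n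
allPairs-applyUpTo⁻ f (suc n) (r ∷ rs) {suc i} {suc j} (ℕ.s≤s i<j) (ℕ.s≤s j<n) =
  allPairs-applyUpTo⁻ (f ∘ suc) n rs i<j j<n

sumOver-permute : {A : Set a} (finA : Finite A) (σ : A ↔ A) (F : A → ℕ) →
                  sumOver finA (F ∘ Inverse.to σ) ≡ sumOver finA F
sumOver-permute finA σ F = trans
  (sum-cong-≗ {A.size} λ i → cong F (sym (Inverse.strictlyInverseʳ A.enumeration _)))
  (sym (∑-permute (F ∘ A.element)
    (Compose.inverse (Symmetry.inverse A.enumeration) (Compose.inverse σ A.enumeration))))
  where module A = FiniteSetoid finA

module _ {A : Set a} {σ : A ↔ A} where
  open Inverse σ using (to)
  open Cycle

  points-induction : {P : Pred A p} (γ : Cycle σ) → (∀ {x} → P x → P (to x)) → P (base γ) →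
                     ∀ {x} → x ∈ points γ → P x
  points-induction {P = P} γ step pb x∈γ with i , _ , refl ← ∈-applyUpTo⁻ (λ i → σ ^ i · base γ) x∈γ = iterate i
    where
    iterate : ∀ i → P (σ ^ i · base γ)
    iterate zero    = pb
    iterate (suc i) = step (iterate i)

  on-points : ∀ {B : Set b} {F : A → B} (γ : Cycle σ) → (∀ x → F (to x) ≡ F x) →
              ∀ {x} → x ∈ points γ → F x ≡ F (base γ)
  on-points {F = F} γ F-inv = points-induction {P = λ x → F x ≡ F (base γ)} γ (λ {x} eq → trans (F-inv x) eq) refl

  base∈points : (γ : Cycle σ) → base γ ∈ points γ
  base∈points γ = ∈-applyUpTo⁺ (λ i → σ ^ i · base γ) (size>0 γ)

  to∈points : ∀ (γ : Cycle σ) {x} → x ∈ points γ → to x ∈ points γ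
  to∈points γ x∈γ with i , i<k , refl ← ∈-applyUpTo⁻ (λ i → σ ^ i · base γ) x∈γ
    with suc i ℕ.≟ size γ
  ... | yes refl = subst (_∈ points γ) (sym (closed γ)) (base∈points γ)
  ... | no  i+1≢k = ∈-applyUpTo⁺ (λ i → σ ^ i · base γ) (ℕ.≤∧≢⇒< i<k i+1≢k)

  card-points : (γ : Cycle σ) → Card (≡.setoid A) (_∈ points γ) (size γ)
  card-points γ = record
    { element    = λ i → σ ^ toℕ i · base γ
    ; satisfies  = λ i → ∈-applyUpTo⁺ (λ i → σ ^ i · base γ) (Fin.toℕ<n i)
    ; injective  = λ {i} {j} eq → Fin.toℕ-injective (inj (Fin.toℕ<n i) (Fin.toℕ<n j) eq)
    ; surjective = λ x∈γ → let i , i<k , eq = ∈-applyUpTo⁻ (λ i → σ ^ i · base γ) x∈γ in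
        fromℕ< i<k , trans (cong (λ i → σ ^ i · base γ) (Fin.toℕ-fromℕ< i<k)) (sym eq)
    }
    where
    distinct-powers : ∀ {i j} → i < j → j < size γ → ¬ σ ^ i · base γ ≡ σ ^ j · base γ
    distinct-powers = allPairs-applyUpTo⁻ (λ i → σ ^ i · base γ) (size γ) (distinct γ)

    inj : ∀ {i j} → i < size γ → j < size γ → σ ^ i · base γ ≡ σ ^ j · base γ → i ≡ j
    inj {i} {j} i<k j<k eq with ℕ.<-cmp i j
    ... | tri< i<j _ _ = contradiction eq (distinct-powers i<j j<k)
    ... | tri≈ _ i≡j _ = i≡j
    ... | tri> _ _ j<i = contradiction (sym eq) (distinct-powers j<i i<k)

  disjoint-lookup : ∀ {γs : List (Cycle σ)} → AllPairs (Disjoint on points) γs → ∀ {x} i j →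
                    x ∈ points (List.lookup γs i) → x ∈ points (List.lookup γs j) → i ≡ j
  disjoint-lookup (_ ∷ _)  zero    zero    _  _  = refl
  disjoint-lookup (r ∷ _)  zero    (suc j) x∈ y∈ = contradiction (x∈ , y∈) (All.lookup r (∈-lookup j))
  disjoint-lookup (r ∷ _)  (suc i) zero    x∈ y∈ = contradiction (y∈ , x∈) (All.lookup r (∈-lookup i))
  disjoint-lookup (_ ∷ rs) (suc i) (suc j) x∈ y∈ = cong suc (disjoint-lookup rs i j x∈ y∈)

  module CycleOf (finA : Finite A) (D : CycleDecomposition σ) where
    open CycleDecomposition D
    private
      module A = FiniteSetoid finA

    cycle : Fin (length cycles) → Cycle σ
    cycle = List.lookup cycles

    cycleOf : A → Fin (length cycles)
    cycleOf x = Any.index (covers x)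

    ∈-cycleOf : ∀ x → x ∈ points (cycle (cycleOf x))
    ∈-cycleOf x = Any.lookup-index (covers x)

    cycleOf-unique : ∀ {x} i → x ∈ points (cycle i) → cycleOf x ≡ i
    cycleOf-unique {x} i x∈ = disjoint-lookup disjoint (cycleOf x) i (∈-cycleOf x) x∈

    cycleOf-to : ∀ x → cycleOf (to x) ≡ cycleOf x
    cycleOf-to x = cycleOf-unique (cycleOf x) (to∈points (cycle (cycleOf x)) (∈-cycleOf x))

    cycleOf-base : ∀ i → cycleOf (base (cycle i)) ≡ i
    cycleOf-base i = cycleOf-unique i (base∈points (cycle i))

    private
      finA-card : Card (≡.setoid A) U A.size
      finA-card = record
        { element    = A.element
        ; satisfies  = λ _ → _
        ; injective  = λ {i} {j} eq → trans (sym (Inverse.strictlyInverseˡ A.enumeration i))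
            (trans (cong A.index eq) (Inverse.strictlyInverseˡ A.enumeration j))
        ; surjective = λ {x} _ → A.index x , Inverse.strictlyInverseʳ A.enumeration x
        }

    size≤ : (γ : Cycle σ) → size γ ≤ A.size
    size≤ γ = card-mono (λ _ → _) (card-points γ) finA-card

    private
      count-points : ∀ j → sum (λ i → ⟦ cycleOf (A.element i) Fin.≟ j ⟧) ≡ size (cycle j)
      count-points j = card-unique
        (λ { {x} (_ , refl) → ∈-cycleOf x })
        (λ x∈ → _ , cycleOf-unique j x∈)
        (card-∩ {Q = λ x → cycleOf x ≡ j} (λ { refl eq → eq }) finA-card (λ i → cycleOf (A.element i) Fin.≟ j))
        (card-points (cycle j))

    sumOver-cycles : (F : A → ℕ) → (∀ x → F (to x) ≡ F x) →
                     sumOver finA F ≡ sum λ j → size (cycle j) * F (base (cycle j))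
    sumOver-cycles F F-inv = trans (sum-fibres (cycleOf ∘ A.element) (F ∘ A.element))
      (sum-cong-≗ λ j → trans (sum-cong-≗ (term j))
        (trans (sym (*-distribʳ-sum (F (base (cycle j))) λ i → ⟦ cycleOf (A.element i) Fin.≟ j ⟧))
          (cong (_* F (base (cycle j))) (count-points j))))
      where
      term : ∀ j i → ⟦ cycleOf (A.element i) Fin.≟ j ⟧ * F (A.element i)
                   ≡ ⟦ cycleOf (A.element i) Fin.≟ j ⟧ * F (base (cycle j))
      term j i with cycleOf (A.element i) Fin.≟ j
      ... | yes refl = cong (1 *_) (on-points (cycle _) F-inv (∈-cycleOf (A.element i)))
      ... | no  _    = refl

-- Colorings

module _ {X : Set a} {Y : Set b} {ΩX : Set d} {ΩY : Set e} where

  SameSide : X ⊎ Y → ΩX ⊎ ΩY → Set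
  SameSide (inj₁ _) (inj₁ _) = ⊤
  SameSide (inj₁ _) (inj₂ _) = ⊥
  SameSide (inj₂ _) (inj₁ _) = ⊥
  SameSide (inj₂ _) (inj₂ _) = ⊤

  sameSide⁺ : ∀ {z κ} → SameSide z κ → (InLeft κ ⇔ InLeft z) × (InRight κ ⇔ InRight z)
  sameSide⁺ {inj₁ x} {inj₁ κ} _ = mk⇔ (λ _ → x , refl) (λ _ → κ , refl) , mk⇔ (λ { (_ , ()) }) (λ { (_ , ()) })
  sameSide⁺ {inj₂ y} {inj₂ κ} _ = mk⇔ (λ { (_ , ()) }) (λ { (_ , ()) }) , mk⇔ (λ _ → y , refl) (λ _ → κ , refl)

  sameSide⁻ : ∀ {z κ} → (InLeft κ ⇔ InLeft z) × (InRight κ ⇔ InRight z) → SameSide z κ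
  sameSide⁻ {inj₁ x} (l , r) with _ , refl ← Equivalence.from l (x , refl) = tt
  sameSide⁻ {inj₂ y} (l , r) with _ , refl ← Equivalence.from r (y , refl) = tt

  sameSide-resp : ∀ {z z′ κ} → (InLeft z → InLeft z′) → (InRight z → InRight z′) → SameSide z κ → SameSide z′ κ
  sameSide-resp {inj₁ x} {κ = inj₁ κ} l r _ with _ , refl ← l (x , refl) = tt
  sameSide-resp {inj₂ y} {κ = inj₂ κ} l r _ with _ , refl ← r (y , refl) = tt

  coloring : (φ : X ⊎ Y → ΩX ⊎ ΩY) → (∀ z → SameSide z (φ z)) → Coloring X Y ΩX ΩY
  coloring φ valid = record { color = φ ; valid = λ z → sameSide⁺ (valid z) }

open Coloring using (color; valid)

module FixedColorings
  {X : Set a} {Y : Set b} (finX : Finite X) (finY : Finite Y)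
  {ΩX : Set d} {ΩY : Set e} {ωX : ΩX → ℕ} {ωY : ΩY → ℕ} (fibX : FiniteFibres ωX) (fibY : FiniteFibres ωY)
  where

  finA : Finite (X ⊎ Y)
  finA = ⊎-finite finX finY

  |A| : ℕ
  |A| = FiniteSetoid.size finA

  weight : Coloring X Y ΩX ΩY → ℕ
  weight φ = Coloring.totalWeight φ finX finY ωX ωY

  private
    fX = generatingFunction fibX
    fY = generatingFunction fibY

    ω : ΩX ⊎ ΩY → ℕ
    ω = [ ωX , ωY ]′

  weight-sumOver : ∀ φ → weight φ ≡ sumOver finA (ω ∘ color φ)
  weight-sumOver φ = sym (trans (sum-↑ X.size _) (cong₂ _+_
    (sum-cong-≗ λ i → trans (cong (ω ∘ color φ ∘ elt) (Fin.splitAt-↑ˡ X.size i Y.size))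
      (cong ω (proj₂ (Equivalence.from (proj₁ (valid φ (inj₁ (X.element i)))) (X.element i , refl)))))
    (sum-cong-≗ λ j → trans (cong (ω ∘ color φ ∘ elt) (Fin.splitAt-↑ʳ X.size Y.size j))
      (cong ω (proj₂ (Equivalence.from (proj₂ (valid φ (inj₂ (Y.element j)))) (Y.element j , refl)))))))
    where
    module X = FiniteSetoid finX
    module Y = FiniteSetoid finY
    elt : Fin X.size ⊎ Fin Y.size → X ⊎ Y
    elt = Sum.map X.element Y.element

  weight-cong : ∀ {φ ψ} → color φ ≗ color ψ → weight φ ≡ weight ψ
  weight-cong {φ} {ψ} φ≗ψ = trans (weight-sumOver φ)
    (trans (sum-cong-≗ {|A|} λ i → cong ω (φ≗ψ _)) (sym (weight-sumOver ψ)))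

  weight-∘ : ∀ (σ : (X ⊎ Y) ↔ (X ⊎ Y)) {φ ψ} → color ψ ≗ color φ ∘ Inverse.to σ → weight ψ ≡ weight φ
  weight-∘ σ {φ} {ψ} ψ≗ = trans (weight-sumOver ψ) (trans (sum-cong-≗ {|A|} λ i → cong ω (ψ≗ _))
    (trans (sumOver-permute finA σ (ω ∘ color φ)) (sym (weight-sumOver φ))))

  private
    series : X ⊎ Y → PowerSeries
    series = [ (λ _ → fX) , (λ _ → fY) ]′

    series-Ω : ∀ z → Series (≡.setoid (ΩX ⊎ ΩY)) (SameSide z) ω (series z)
    series-Ω (inj₁ x) = series-fibres fibX inj₁ inj₁-injective _ (λ { {inj₁ κ} _ → κ , refl }) (λ _ → refl)
    series-Ω (inj₂ y) = series-fibres fibY inj₂ inj₂-injective _ (λ { {inj₂ κ} _ → κ , refl }) (λ _ → refl)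

  module _ (σ : (X ⊎ Y) ↔ (X ⊎ Y))
           (preserves : ∀ z → (InLeft (Inverse.to σ z) ⇔ InLeft z) × (InRight (Inverse.to σ z) ⇔ InRight z)) where
    open Inverse σ using (to)
    open Cycle using (base; points; size>0)
    open CycleDecomposition (cycleDecomposition finA σ) using (cycles)
    open CycleOf {σ = σ} finA (cycleDecomposition finA σ)

    FixedBy : Pred (Coloring X Y ΩX ΩY) _
    FixedBy φ = color φ ∘ to ≗ color φ

    private
      stepˡ : ∀ {z} → InLeft z → InLeft (to z)
      stepˡ = Equivalence.from (proj₁ (preserves _))

      stepʳ : ∀ {z} → InRight z → InRight (to z)
      stepʳ = Equivalence.from (proj₂ (preserves _))

      cycleSeries : Cycle σ → PowerSeries
      cycleSeries γ = atPower (Cycle.size γ) {{ℕ.>-nonZero (size>0 γ)}} (series (base γ))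

      extend : (t : Fin (length cycles) → ΩX ⊎ ΩY) → (∀ i → SameSide (base (cycle i)) (t i)) → Coloring X Y ΩX ΩY
      extend t valid-t = coloring (t ∘ cycleOf) λ z →
        points-induction {P = λ z′ → SameSide z′ (t (cycleOf z))} (cycle (cycleOf z)) (sameSide-resp stepˡ stepʳ)
          (valid-t (cycleOf z)) (∈-cycleOf z)

    series-fixed : Series (colorings X Y ΩX ΩY) FixedBy weight (product (cycleSeries ∘ cycle))
    series-fixed = series-map extend
      (λ _ _ t≗ z → t≗ (cycleOf z))
      (λ {t} _ z → cong t (cycleOf-to z))
      (λ {t} {t′} _ _ eq i → trans (cong t (sym (cycleOf-base i)))
        (trans (eq (base (cycle i))) (cong t′ (cycleOf-base i))))
      (λ {φ} fixed → color φ ∘ base ∘ cycle , (λ i → sameSide⁻ (valid φ (base (cycle i)))) ,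
        λ z → sym (on-points {F = color φ} (cycle (cycleOf z)) fixed (∈-cycleOf z)))
      (λ {φ} {ψ} → weight-cong {φ} {ψ})
      (λ {t} valid-t → trans (weight-sumOver (extend t valid-t))
        (trans (sumOver-cycles (ω ∘ t ∘ cycleOf) (λ z → cong (ω ∘ t) (cycleOf-to z)))
          (sum-cong-≗ λ i → cong (λ j → Cycle.size (cycle i) * ω (t j)) (cycleOf-base i))))
      (series-Π λ i →
        series-scale (Cycle.size (cycle i)) {{ℕ.>-nonZero (size>0 (cycle i))}} (series-Ω (base (cycle i))))

    private
      z : Fin |A| ⊎ Fin |A| → PowerSeries
      z = [ atPowers |A| fX , atPowers |A| fY ]′

      Q : Fin |A| ⊎ Fin |A| → Pred (Cycle σ) (a ⊔ b)
      Q (inj₁ k) γ = Cycle.size γ ≡ suc (toℕ k) × All InLeft (points γ)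
      Q (inj₂ k) γ = Cycle.size γ ≡ suc (toℕ k) × All InRight (points γ)

      Q? : ∀ s → Decidable (Q s)
      Q? (inj₁ k) γ = (Cycle.size γ ℕ.≟ suc (toℕ k)) ×-dec all? inLeft? (points γ)
      Q? (inj₂ k) γ = (Cycle.size γ ℕ.≟ suc (toℕ k)) ×-dec all? inRight? (points γ)

      variableOf : (γ : Cycle σ) → ∃ λ s → Q s γ × (∀ s′ → Q s′ γ → s′ ≡ s) × cycleSeries γ ≗ z s
      variableOf γ = go (proj₂ (asIndex (size>0 γ) (size≤ γ))) (base γ) refl
        where
        asIndex : ∀ {m} → 0 < m → m ≤ |A| → ∃ λ (k : Fin |A|) → m ≡ suc (toℕ k)
        asIndex {suc m} _ m<A = fromℕ< m<A , cong suc (sym (Fin.toℕ-fromℕ< m<A))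

        atPower-cong : ∀ {k l} .{{_ : NonZero k}} .{{_ : NonZero l}} {f g} → k ≡ l → f ≡ g → atPower k f ≗ atPower l g
        atPower-cong refl refl w = refl

        go : ∀ {k} → Cycle.size γ ≡ suc (toℕ k) → ∀ z₀ → base γ ≡ z₀ →
             ∃ λ s → Q s γ × (∀ s′ → Q s′ γ → s′ ≡ s) × cycleSeries γ ≗ z s
        go {k} size≡ (inj₁ x) base≡ = inj₁ k ,
          (size≡ , All.tabulate (points-induction γ stepˡ (x , base≡))) ,
          (λ { (inj₁ k′) (size≡′ , _) → cong inj₁ (Fin.toℕ-injective (ℕ.suc-injective (trans (sym size≡′) size≡)))
             ; (inj₂ k′) (_ , right) →
                 contradiction (trans (sym base≡) (proj₂ (All.lookup right (base∈points γ)))) λ () }) ,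
          atPower-cong {{ℕ.>-nonZero (size>0 γ)}} size≡ (cong series base≡)
        go {k} size≡ (inj₂ y) base≡ = inj₂ k ,
          (size≡ , All.tabulate (points-induction γ stepʳ (y , base≡))) ,
          (λ { (inj₁ k′) (_ , left) →
                 contradiction (trans (sym base≡) (proj₂ (All.lookup left (base∈points γ)))) λ ()
             ; (inj₂ k′) (size≡′ , _) → cong inj₂ (Fin.toℕ-injective (ℕ.suc-injective (trans (sym size≡′) size≡))) }) ,
          atPower-cong {{ℕ.>-nonZero (size>0 γ)}} size≡ (cong series base≡)

    exponentsX exponentsY : Vector ℕ |A|
    exponentsX k = countCycles finA σ inLeft? (suc (toℕ k))
    exponentsY k = countCycles finA σ inRight? (suc (toℕ k))

    product-cycles : product (cycleSeries ∘ cycle) ≗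
      product (λ i → (atPowers |A| fX ++ atPowers |A| fY) i ^ (exponentsX ++ exponentsY) i)
    product-cycles w = sym (trans
      (sum-cong-≋ {|A| + |A|} (λ i w → cong (λ k → (z (splitAt |A| i) ^ k) w) (exponent (splitAt |A| i))) w)
      (product-sort ⊛-commutativeMonoid (z ∘ splitAt |A|) cycleSeries (Q? ∘ splitAt |A|) sort cycles w))
      where
      open MonoidSum ⊛-commutativeMonoid using (sum-cong-≋)

      exponent : ∀ s → [ exponentsX , exponentsY ]′ s ≡ length (filter (Q? s) cycles)
      exponent (inj₁ k) = refl
      exponent (inj₂ k) = refl

      sort : ∀ γ → ∃ λ j → Q (splitAt |A| j) γ × (∀ i → Q (splitAt |A| i) γ → i ≡ j) × cycleSeries γ ≗ z (splitAt |A| j)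
      sort γ with s , qs , unique , series≗ ← variableOf γ =
        join |A| |A| s , subst (λ s → Q s γ) (sym (Fin.splitAt-join |A| |A| s)) qs ,
        (λ i qi → trans (sym (Fin.join-splitAt |A| |A| i)) (cong (join |A| |A|) (unique (splitAt |A| i) qi))) ,
        subst (λ s → cycleSeries γ ≗ z s) (sym (Fin.splitAt-join |A| |A| s)) series≗

evaluate-tabulate : ∀ {m n} (z : Vector PowerSeries m) (t : Fin n → ℚ × Vector ℕ m) w →
                    evaluate z (List.tabulate t) w ≡ Σℚ.sum (λ k → evaluateTerm z (t k) w)
evaluate-tabulate {n = zero}  z t w = refl
evaluate-tabulate {n = suc n} z t w = cong (evaluateTerm z (t zero) w ℚ.+_) (evaluate-tabulate z (t ∘ suc) w)

module _ {G : Group c ℓ} {X : Set a} {Y : Set b} (Γ : Action G (setoid (X ⊎ Y)))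
         (pres : PartitionPreserving Γ) {ΩX : Set d} {ΩY : Set e} where
  open Inverse using (to; from; strictlyInverseˡ; strictlyInverseʳ)
  open IsGroupHomomorphism (Action.isGroupHomomorphism Γ) using (⟦⟧-cong; ε-homo; ⁻¹-homo; homo)

  private
    SidePreserving : (X ⊎ Y → X ⊎ Y) → Set _
    SidePreserving h = ∀ z → (InLeft (h z) ⇔ InLeft z) × (InRight (h z) ⇔ InRight z)

    precompose : (h : X ⊎ Y → X ⊎ Y) → SidePreserving h → Coloring X Y ΩX ΩY → Coloring X Y ΩX ΩY
    precompose h h-pres φ = record
      { color = color φ ∘ h
      ; valid = λ z → Compose.equivalence (proj₁ (valid φ (h z))) (proj₁ (h-pres z))
                    , Compose.equivalence (proj₂ (valid φ (h z))) (proj₂ (h-pres z))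
      }

    pres⁻¹ : ∀ g → SidePreserving (from (Action.Γ Γ g))
    pres⁻¹ g z = Product.map Symmetry.equivalence Symmetry.equivalence
      (subst (λ z′ → (InLeft z′ ⇔ InLeft (from σ z)) × (InRight z′ ⇔ InRight (from σ z)))
        (strictlyInverseˡ σ z) (pres g (from σ z)))
      where σ = Action.Γ Γ g

  coloringAction : Action (Op.group G) (colorings X Y ΩX ΩY)
  coloringAction = record
    { Γ = λ g → let σ = Action.Γ Γ g in record
      { to        = precompose (to σ) (pres g)
      ; from      = precompose (from σ) (pres⁻¹ g)
      ; to-cong   = λ φ≗ψ z → φ≗ψ (to σ z)
      ; from-cong = λ φ≗ψ z → φ≗ψ (from σ z)
      ; inverse   = (λ {φ} eq z → trans (eq (to σ z)) (cong (color φ) (strictlyInverseʳ σ z)))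
                  , (λ {φ} eq z → trans (eq (from σ z)) (cong (color φ) (strictlyInverseˡ σ z)))
      }
    ; isGroupHomomorphism = record
      { isMonoidHomomorphism = record
        { isMagmaHomomorphism = record
          { isRelHomomorphism = record { cong = λ g≈h φ z → cong (color φ) (⟦⟧-cong g≈h z) }
          ; homo = λ g h φ z → cong (color φ) (homo h g z)
          }
        ; ε-homo = λ φ z → cong (color φ) (ε-homo z)
        }
      ; ⁻¹-homo = λ g φ z → cong (color φ) (⁻¹-homo g z)
      }
    }

module OrbitCount
  {G : Group c ℓ} (finG : FiniteSetoid (Group.setoid G)) {X : Set a} {Y : Set b} (finX : Finite X) (finY : Finite Y)
  (Γ : Action G (setoid (X ⊎ Y))) (pres : PartitionPreserving Γ)
  {ΩX : Set d} {ΩY : Set e} {ωX : ΩX → ℕ} {ωY : ΩY → ℕ} (fibX : FiniteFibres ωX) (fibY : FiniteFibres ωY) where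

  open FixedColorings finX finY fibX fibY
  open IsGroupHomomorphism (Action.isGroupHomomorphism Γ) using (ε-homo)
  private
    module G where
      open Group G public
      open FiniteSetoid finG public

    α : Action (Op.group G) (colorings X Y ΩX ΩY)
    α = coloringAction Γ pres

    fixedSeries = λ g → series-fixed (Action.Γ Γ g) (pres g)

    -- All colorings are fixed by ε, so their finiteness is a case of that of the fixed colorings.
    card-weight : ∀ w → Card (colorings X Y ΩX ΩY) (λ φ → weight φ ≡ w) (count (fixedSeries G.ε) w)
    card-weight w = card-resp proj₂ (λ {φ} eq → (λ z → cong (color φ) (ε-homo z)) , eq) (card (fixedSeries G.ε) w)

    module B w = Burnside finG α {P = λ φ → weight φ ≡ w}
      (λ {φ} {ψ} φ≗ψ eq → trans (sym (weight-cong {φ} {ψ} φ≗ψ)) eq)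
      (λ g {φ} eq → trans (weight-∘ (Action.Γ Γ g) {φ} {Action.act α g φ} (λ _ → refl)) eq)
      (card-weight w)

    instance
      |G|≢0 : NonZero G.size
      |G|≢0 = Fin.nonZeroIndex (G.index G.ε)

  weightOrbits : ∀ w → FiniteSetoid (orbitsConsistingOf α λ φ → weight φ ≡ w)
  weightOrbits w = B.finiteOrbits w

  orbitSeries : (λ w → fromℕ (FiniteSetoid.size (weightOrbits w)))
    ≗ evaluate (atPowers |A| (generatingFunction fibX) ++ atPowers |A| (generatingFunction fibY))
               (bipartiteCycleIndex finG finX finY Γ)
  orbitSeries w = begin
    fromℕ R                                       ≡⟨ 1/n*[m*n]≡m R G.size ⟨
    1/|G| ℚ.* fromℕ (R * G.size)                  ≡⟨ cong (λ k → 1/|G| ℚ.* fromℕ k) (B.burnside w F fixed) ⟩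
    1/|G| ℚ.* fromℕ (sum F)                       ≡⟨ cong (1/|G| ℚ.*_) (fromℕ-sum F) ⟩
    1/|G| ℚ.* Σℚ.sum (fromℕ ∘ F)                  ≡⟨ Σℚ.*-distribˡ-sum 1/|G| (fromℕ ∘ F) ⟩
    Σℚ.sum (λ k → 1/|G| ℚ.* fromℕ (F k))          ≡⟨ Σℚ.sum-cong-≗ (λ k → cong (1/|G| ℚ.*_) (term k)) ⟩
    Σℚ.sum (λ k → evaluateTerm z (monomial k) w)  ≡⟨ evaluate-tabulate z monomial w ⟨
    evaluate z (bipartiteCycleIndex finG finX finY Γ) w ∎
    where
    open ≡-Reasoning
    R = FiniteSetoid.size (weightOrbits w)
    1/|G| = ℤ.1ℤ ℚ./ G.size
    z = atPowers |A| (generatingFunction fibX) ++ atPowers |A| (generatingFunction fibY)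

    F : Fin G.size → ℕ
    F k = count (fixedSeries (G.element k)) w

    fixed : ∀ k → Card (colorings X Y ΩX ΩY) ((λ φ → weight φ ≡ w) ∩ B.Fixed w (G.element k)) (F k)
    fixed k = card-resp swap swap (card (fixedSeries (G.element k)) w)

    monomial : Fin G.size → ℚ × Vector ℕ (|A| + |A|)
    monomial k = 1/|G| , exponents finG finX finY Γ (cyclesInX finG finX finY Γ) (G.element k)
                      ++ exponents finG finX finY Γ (cyclesInY finG finX finY Γ) (G.element k)

    term : ∀ k → fromℕ (F k) ≡ _
    term k = trans (sym (coeff (fixedSeries (G.element k)) w))
      (product-cycles (Action.Γ Γ (G.element k)) (pres (G.element k)) w)

theorem1 :
    ∀ {c ℓ a b d e} (G : Group c ℓ) (finG : FiniteSetoid (Group.setoid G))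
    (X : Set a) (Y : Set b) (finX : Finite X) (finY : Finite Y)
    (Γ : Action G (setoid (X ⊎ Y))) → PartitionPreserving Γ →
    (ΩX : Set d) (ΩY : Set e) (ωX : ΩX → ℕ) (ωY : ΩY → ℕ) →
    (∀ κ → 0 < ωX κ) → (∀ κ → 0 < ωY κ) →
    (fibX : FiniteFibres ωX) (fibY : FiniteFibres ωY) →
    let n = FiniteSetoid.size (⊎-finite finX finY)
        fX = generatingFunction fibX
        fY = generatingFunction fibY
    in
    -- (gφ)(z) = φ(gz) gives h(gφ) = (gh)φ: a right action of G.
    Σ[ α ∈ Action (Op.group G) (colorings X Y ΩX ΩY) ]
      (∀ g φ z → Coloring.color (Action.act α g φ) z ≡ Coloring.color φ (Action.act Γ g z)) ×
      (Σ[ orb ∈ (∀ w → FiniteSetoid (orbitsConsistingOf α λ φ → Coloring.totalWeight φ finX finY ωX ωY ≡ w)) ]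
        (λ w → fromℕ (FiniteSetoid.size (orb w)))
          ≗ evaluate (atPowers n fX ++ atPowers n fY) (bipartiteCycleIndex finG finX finY Γ))
theorem1 G finG X Y finX finY Γ pres ΩX ΩY ωX ωY _ _ fibX fibY =
  coloringAction Γ pres , (λ _ _ _ → refl) , weightOrbits , orbitSeries
  where open OrbitCount finG finX finY Γ pres fibX fibY
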